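{- Every complete graph has the strong polynomial Rödl property; that is, for every complete graph $H$ there exists a constant $C_H>0$ such that for every $0<\varepsilon\le 1/2$, every $H$-free graph $G$ admits a partition of $V(G)$ into at most $(1/\varepsilon)^{C_H}$ sets, each of which is strongly $\varepsilon$-restricted.
   Context: All graphs are finite and simple. A graph $G$ is $H$-free if it contains no induced subgraph isomorphic to $H$. For $\varepsilon>0$, a set $S\subseteq V(G)$ is strongly $\varepsilon$-restricted if one of $G[S]$ and $\overline{G}[S]$ (the induced subgraph of $G$ or of its complement on $S$) has maximum degree at most $\varepsilon|S|$. -}

module Defs where

open import Data.Nat using (ℕ; zero; suc; _+_; _*_; _≤_)
open import Data.Bool using (Bool; true; false; not; _∧_; if_then_else_)
open import Data.Fin using (Fin; zero; suc)
open import Data.Fin.Properties using (_≟_)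
open import Data.Product using (Σ; _×_)
open import Data.Sum using (_⊎_)
open import Relation.Nullary using (¬_)
open import Relation.Nullary.Decidable using (⌊_⌋)
open import Relation.Binary.PropositionalEquality using (_≡_)
open import Function.Definitions using (Injective)

record Graph (n : ℕ) : Set where
  field
    adj   : Fin n → Fin n → Bool
    sym   : ∀ i j → adj i j ≡ adj j i
    loopless : ∀ i → adj i i ≡ false
open Graph public

_==_ : ∀ {n} → Fin n → Fin n → Bool
i == j = ⌊ i ≟ j ⌋

complement : ∀ {n} → Graph n → Graph n
complement {n} G = record
  { adj = λ i j → not (adj G i j) ∧ not (i == j)
  ; sym = symc
  ; loopless = loopc }
  where
  open import Relation.Binary.PropositionalEquality using (refl; cong₂; cong)
  open import Relation.Nullary.Decidable using (yes; no)
  eqsym : ∀ (i j : Fin n) → (i == j) ≡ (j == i)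
  eqsym i j with i ≟ j | j ≟ i
  ... | yes _ | yes _ = refl
  ... | no _ | no _ = refl
  ... | yes p | no q = Data.Empty.⊥-elim (q (Relation.Binary.PropositionalEquality.sym p))
    where import Data.Empty
  ... | no p | yes q = Data.Empty.⊥-elim (p (Relation.Binary.PropositionalEquality.sym q))
    where import Data.Empty
  symc : ∀ i j → (not (adj G i j) ∧ not (i == j)) ≡ (not (adj G j i) ∧ not (j == i))
  symc i j = cong₂ _∧_ (cong not (sym G i j)) (cong not (eqsym i j))
  loopc : ∀ i → (not (adj G i i) ∧ not (i == i)) ≡ false
  loopc i with i ≟ i
  ... | yes _ = Data.Bool.Properties.∧-zeroʳ (not (adj G i i))
    where import Data.Bool.Properties
  ... | no ¬p = Data.Empty.⊥-elim (¬p refl)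
    where import Data.Empty

complete : (t : ℕ) → Graph t
complete t = record
  { adj = λ i j → not (i == j)
  ; sym = symk
  ; loopless = loopk }
  where
  open import Relation.Binary.PropositionalEquality using (refl; cong)
  open import Relation.Nullary.Decidable using (yes; no)
  open import Data.Empty using (⊥-elim)
  symk : ∀ (i j : Fin t) → not (i == j) ≡ not (j == i)
  symk i j with i ≟ j | j ≟ i
  ... | yes _ | yes _ = refl
  ... | no _ | no _ = refl
  ... | yes p | no q = ⊥-elim (q (Relation.Binary.PropositionalEquality.sym p))
  ... | no p | yes q = ⊥-elim (p (Relation.Binary.PropositionalEquality.sym q))
  loopk : ∀ i → not (i == i) ≡ false
  loopk i with i ≟ i
  ... | yes _ = refl
  ... | no ¬p = ⊥-elim (¬p refl)

InducedCopy : ∀ {m n} → Graph m → Graph n → Set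
InducedCopy {m} {n} H G =
  Σ (Fin m → Fin n) λ f → Injective _≡_ _≡_ f × (∀ i j → adj G (f i) (f j) ≡ adj H i j)

Free : ∀ {m n} → Graph m → Graph n → Set
Free H G = ¬ InducedCopy H G

count : ∀ {n} → (Fin n → Bool) → ℕ
count {zero} P = 0
count {suc n} P = (if P zero then 1 else 0) + count (λ i → P (suc i))

degIn : ∀ {n} → Graph n → (Fin n → Bool) → Fin n → ℕ
degIn G S v = count (λ u → S u ∧ adj G v u)

MaxDegAtMost : ∀ {n} → Graph n → (p q : ℕ) → (Fin n → Bool) → Set
MaxDegAtMost G p q S = ∀ v → S v ≡ true → q * degIn G S v ≤ p * count S

StronglyRestricted : ∀ {n} → Graph n → (p q : ℕ) → (Fin n → Bool) → Set
StronglyRestricted G p q S = MaxDegAtMost G p q S ⊎ MaxDegAtMost (complement G) p q S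

{-# OPTIONS --safe #-}
module Submission where

-- Let m ≈ 1/ε, and let G have no clique of size t. By greedy descent into neighbourhoods, every
-- set contains a sparse subset of polynomial proportion, so polynomially many sparse sets exhaust
-- all but an exponentially small part R of V(G); the difficulty is to place R. A vertex of R with
-- few neighbours in some much larger sparse set (a core) can be added to that core. Otherwise R
-- consists of vertices with many neighbours in every core, and the plan is to make the cores
-- A₁, …, Aₖ rich: any large subsets Dᵢ ⊆ Aᵢ together contain a clique of size k. Richness of
-- t - 1 cores leaves no such vertex. To get one more core from R, repeatedly remove from some Aᵢ a
-- large subset D to which many vertices of R are sparse, and restrict R to those vertices. As
-- these have many neighbours in Aᵢ but few in the removed sets, a polynomial part of Aᵢ survives,
-- so the process stops after polynomially many steps. By then R has shrunk exponentially at most,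
-- which is harmless because the vertices left to be placed can be made far fewer still.

open import Defs hiding (sym)
open import Data.Nat using (ℕ; zero; suc; _+_; _*_; _^_; _≤_; _<_; z≤n; s≤s; s≤s⁻¹; _≤?_; _<?_;
                            ⌊_/2⌋; ⌈_/2⌉; NonZero; >-nonZero)
open import Data.Nat.DivMod using (_/_; _%_; m≡m%n+[m/n]*n; m%n<n; m/n*n≤m)
open import Data.Nat.Properties hiding (_≟_; suc-injective)
open import Data.Bool using (Bool; true; false; not; _∧_; _∨_; if_then_else_)
open import Data.Fin using (Fin; zero; suc)
open import Data.Fin.Properties using (_≟_; any?; all?; suc-injective)
open import Data.Product using (Σ; _×_; _,_; proj₁; proj₂; ∃-syntax)
open import Data.Sum using (_⊎_; inj₁; inj₂; [_,_]′)
open import Data.Empty using (⊥; ⊥-elim)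
open import Data.Unit using (⊤; tt)
open import Function using (_∘_)
open import Relation.Nullary using (¬_; Dec; yes; no; contradiction)
open import Relation.Nullary.Decidable using (⌊_⌋; map′; _×-dec_; _⊎-dec_; _→-dec_; ¬?)
open import Relation.Binary.PropositionalEquality using (_≡_; refl; sym; trans; cong; cong₂; subst)

private variable
  n k : ℕ

-- Finite sets of vertices

Sub : ℕ → Set
Sub n = Fin n → Bool

-- A record rather than a synonym, so that the set can be inferred from a membership proof.
record _∈_ (v : Fin n) (S : Sub n) : Set where
  constructor mem
  field isTrue : S v ≡ true
open _∈_

_∉_ : Fin n → Sub n → Set
v ∉ S = ¬ v ∈ S

_⊆_ : Sub n → Sub n → Set
S ⊆ T = ∀ {v} → v ∈ S → v ∈ T

infixr 7 _∩_
infixr 6 _∪_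
infixl 6 _∖_
infix 4 _∈_ _∉_ _⊆_

private variable
  S T U W W′ : Sub n
  v : Fin n

_∈?_ : (v : Fin n) (S : Sub n) → Dec (v ∈ S)
v ∈? S with S v in eq
... | true  = yes (mem eq)
... | false = no λ p → contradiction (trans (sym eq) (isTrue p)) λ ()

∉⇒false : v ∉ S → S v ≡ false
∉⇒false {v = v} {S = S} v∉S with S v in eq
... | true  = contradiction (mem eq) v∉S
... | false = refl

-- Opacity lets unification read S and T off S ∩ T.
opaque
  _∩_ _∪_ _∖_ : Sub n → Sub n → Sub n
  (S ∩ T) v = S v ∧ T v
  (S ∪ T) v = S v ∨ T v
  (S ∖ T) v = S v ∧ not (T v)

  ∅ full : Sub n
  ∅ v = false
  full v = true

  ∩-intro : v ∈ S → v ∈ T → v ∈ S ∩ T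
  ∩-intro (mem p) (mem q) = mem (cong₂ _∧_ p q)

  ∩-elim : v ∈ S ∩ T → v ∈ S × v ∈ T
  ∩-elim {v = v} {S = S} {T = T} (mem p) with S v in eq
  ... | true = mem eq , mem p

  ∖-intro : v ∈ S → v ∉ T → v ∈ S ∖ T
  ∖-intro (mem p) q = mem (cong₂ _∧_ p (cong not (∉⇒false q)))

  ∖-elim : v ∈ S ∖ T → v ∈ S × v ∉ T
  ∖-elim {v = v} {S = S} {T = T} (mem p) with S v in eq | T v in eq′
  ... | true | false = mem eq , λ (mem r) → contradiction (trans (sym eq′) r) λ ()

  ∪-introˡ : v ∈ S → v ∈ S ∪ T
  ∪-introˡ {v = v} {T = T} (mem p) = mem (cong (_∨ T v) p)

  ∪-introʳ : v ∈ T → v ∈ S ∪ T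
  ∪-introʳ {v = v} {S = S} (mem p) with S v in eq
  ... | true  = mem (cong (_∨ _) eq)
  ... | false = mem (cong₂ _∨_ eq p)

  ∪-elim : v ∈ S ∪ T → v ∈ S ⊎ v ∈ T
  ∪-elim {v = v} {S = S} (mem p) with S v in eq
  ... | true  = inj₁ (mem eq)
  ... | false = inj₂ (mem p)

  ∅-elim : v ∉ ∅
  ∅-elim ()

  full-intro : v ∈ full
  full-intro = mem refl

opaque
  ⋃ : (Fin k → Sub n) → Sub n
  ⋃ {zero}  A = ∅
  ⋃ {suc k} A = A zero ∪ ⋃ (A ∘ suc)

  ⋃-intro : ∀ {A : Fin k → Sub n} i → v ∈ A i → v ∈ ⋃ A
  ⋃-intro zero    p = ∪-introˡ p
  ⋃-intro (suc i) p = ∪-introʳ (⋃-intro i p)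

  ⋃-elim : ∀ {A : Fin k → Sub n} → v ∈ ⋃ A → ∃[ i ] v ∈ A i
  ⋃-elim {k = zero}  p = ⊥-elim (∅-elim p)
  ⋃-elim {k = suc k} p with ∪-elim p
  ... | inj₁ q = zero , q
  ... | inj₂ q with ⋃-elim q
  ...   | i , r = suc i , r

opaque
  unfolding _∩_

  ∣_∣ : Sub n → ℕ
  ∣ S ∣ = count S

  ∣∣-mono : S ⊆ T → ∣ S ∣ ≤ ∣ T ∣
  ∣∣-mono = count-mono _ _
    where
    count-mono : ∀ {n} (S T : Sub n) → S ⊆ T → count S ≤ count T
    count-mono {zero} S T p = z≤n
    count-mono {suc n} S T p = +-mono-≤ head (count-mono (S ∘ suc) (T ∘ suc) λ (mem q) → mem (isTrue (p (mem q))))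
      where
      head : (if S zero then 1 else 0) ≤ (if T zero then 1 else 0)
      head with S zero in eq
      ... | false = z≤n
      ... | true rewrite isTrue (p (mem eq)) = ≤-refl

  ∣∣-split : (S T : Sub n) → ∣ S ∣ ≡ ∣ S ∩ T ∣ + ∣ S ∖ T ∣
  ∣∣-split {zero} S T = refl
  ∣∣-split {suc n} S T rewrite ∣∣-split (S ∘ suc) (T ∘ suc) with S zero | T zero
  ... | false | _     = refl
  ... | true  | true  = refl
  ... | true  | false = sym (+-suc _ _)

  ∣∅∣≡0 : ∣ ∅ {n} ∣ ≡ 0
  ∣∅∣≡0 {zero}  = refl
  ∣∅∣≡0 {suc n} = ∣∅∣≡0 {n}

  ∣S∣>0⇒∃ : (S : Sub n) → 0 < ∣ S ∣ → ∃[ v ] v ∈ S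
  ∣S∣>0⇒∃ {suc n} S p with S zero in eq
  ... | true  = zero , mem eq
  ... | false with ∣S∣>0⇒∃ (S ∘ suc) p
  ...   | v , mem q = suc v , mem q

  v∈S⇒∣S∣>0 : v ∈ S → 0 < ∣ S ∣
  v∈S⇒∣S∣>0 v∈S = positive _ _ v∈S
    where
    positive : ∀ {n} (S : Sub n) v → v ∈ S → 0 < count S
    positive S zero    (mem p) rewrite p = s≤s z≤n
    positive S (suc v) (mem p) = ≤-trans (positive (S ∘ suc) v (mem p)) (m≤n+m _ (if S zero then 1 else 0))

  subset-of-size : ∀ (S : Sub n) j → j ≤ ∣ S ∣ → ∃[ T ] T ⊆ S × ∣ T ∣ ≡ j
  subset-of-size {n} S zero _ = ∅ , (λ p → ⊥-elim (∅-elim p)) , ∣∅∣≡0 {n}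
  subset-of-size {suc n} S (suc j) j<∣S∣ with S zero in eq
  ... | true with subset-of-size (S ∘ suc) j (s≤s⁻¹ j<∣S∣)
  ...   | T , T⊆S , ∣T∣≡j = T⁺ , T⁺⊆S , cong suc ∣T∣≡j
    where
    T⁺ : Sub (suc n)
    T⁺ zero    = true
    T⁺ (suc v) = T v
    T⁺⊆S : T⁺ ⊆ S
    T⁺⊆S {zero}  _       = mem eq
    T⁺⊆S {suc v} (mem p) = mem (isTrue (T⊆S (mem p)))
  subset-of-size {suc n} S (suc j) j<∣S∣ | false with subset-of-size (S ∘ suc) (suc j) j<∣S∣
  ... | T , T⊆S , ∣T∣≡j = T⁺ , T⁺⊆S , ∣T∣≡j
    where
    T⁺ : Sub (suc n)
    T⁺ zero    = false
    T⁺ (suc v) = T v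
    T⁺⊆S : T⁺ ⊆ S
    T⁺⊆S {suc v} (mem p) = mem (isTrue (T⊆S (mem p)))

∣∣-≤-∖ : (S T : Sub n) → ∣ S ∣ ≤ ∣ T ∣ + ∣ S ∖ T ∣
∣∣-≤-∖ S T = begin
  ∣ S ∣                     ≡⟨ ∣∣-split S T ⟩
  ∣ S ∩ T ∣ + ∣ S ∖ T ∣     ≤⟨ +-monoˡ-≤ _ (∣∣-mono (proj₂ ∘ ∩-elim)) ⟩
  ∣ T ∣ + ∣ S ∖ T ∣         ∎
  where open ≤-Reasoning

∣∣-∪ : (S T : Sub n) → ∣ S ∪ T ∣ ≤ ∣ S ∣ + ∣ T ∣
∣∣-∪ S T = ≤-trans (∣∣-≤-∖ (S ∪ T) S) (+-monoʳ-≤ ∣ S ∣ (∣∣-mono drop))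
  where
  drop : (S ∪ T) ∖ S ⊆ T
  drop p with ∖-elim p
  ... | q , v∉S with ∪-elim q
  ...   | inj₁ v∈S = contradiction v∈S v∉S
  ...   | inj₂ v∈T = v∈T

∣∣-disjoint-∪ : (S T : Sub n) → (∀ {v} → v ∈ S → v ∉ T) → ∣ S ∣ + ∣ T ∣ ≤ ∣ S ∪ T ∣
∣∣-disjoint-∪ S T disj = begin
  ∣ S ∣ + ∣ T ∣                         ≤⟨ +-mono-≤ (∣∣-mono λ p → ∩-intro (∪-introˡ p) p)
                                             (∣∣-mono λ p → ∖-intro (∪-introʳ p) λ q → disj q p) ⟩
  ∣ (S ∪ T) ∩ S ∣ + ∣ (S ∪ T) ∖ S ∣     ≡⟨ ∣∣-split (S ∪ T) S ⟨
  ∣ S ∪ T ∣                             ∎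
  where open ≤-Reasoning

_≐_ : Sub n → Sub n → Set
S ≐ T = ∀ v → S v ≡ T v

≐⇒⊆ : S ≐ T → S ⊆ T
≐⇒⊆ p {v} (mem q) = mem (trans (sym (p v)) q)

≐-sym : S ≐ T → T ≐ S
≐-sym p v = sym (p v)

-- Subsets are Boolean functions, finitely many only up to pointwise equality; hence the demand that
-- `P` respect `≐`. Regularisation uses this to search for an offending subset.
any-subset? : {P : Sub n → Set} → (∀ {S T} → S ≐ T → P S → P T) → (∀ S → Dec (P S)) → Dec (∃[ S ] P S)
any-subset? {zero} resp P? = map′ (∅ ,_) (λ (S , p) → resp (λ ()) p) (P? ∅)
any-subset? {suc n} {P} resp P? = map′ to from (search false ⊎-dec search true)
  where
  cons : Bool → Sub n → Sub (suc n)
  cons b S zero    = b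
  cons b S (suc v) = S v
  search : ∀ b → Dec (∃[ S ] P (cons b S))
  search b = any-subset? (λ eq → resp λ { zero → refl ; (suc v) → eq v }) (P? ∘ cons b)
  to : ∃[ S ] P (cons false S) ⊎ ∃[ S ] P (cons true S) → ∃[ S ] P S
  to (inj₁ (S , p)) = cons false S , p
  to (inj₂ (S , p)) = cons true S , p
  from : ∃[ S ] P S → ∃[ S ] P (cons false S) ⊎ ∃[ S ] P (cons true S)
  from (S , p) with S zero in eq
  ... | false = inj₁ (S ∘ suc , resp (λ { zero → eq ; (suc v) → refl }) p)
  ... | true  = inj₂ (S ∘ suc , resp (λ { zero → eq ; (suc v) → refl }) p)

opaque
  ⟪_⟫ : {P : Fin n → Set} → (∀ v → Dec (P v)) → Sub n
  ⟪ P? ⟫ v = ⌊ P? v ⌋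

  ⟪⟫-intro : {P : Fin n → Set} {P? : ∀ v → Dec (P v)} → P v → v ∈ ⟪ P? ⟫
  ⟪⟫-intro {v = v} {P? = P?} p with P? v in eq
  ... | yes _ = mem (cong ⌊_⌋ eq)
  ... | no ¬p = contradiction p ¬p

  ⟪⟫-elim : {P : Fin n → Set} {P? : ∀ v → Dec (P v)} → v ∈ ⟪ P? ⟫ → P v
  ⟪⟫-elim {v = v} {P? = P?} (mem q) with P? v
  ... | yes p = p

-- The union bound for sets of size at most `s / y`, multiplied out to stay within the naturals.
∣⋃∣-bound : ∀ {k} (P : Fin k → Sub n) y s → (∀ i → y * ∣ P i ∣ ≤ s) → y * ∣ ⋃ P ∣ ≤ k * s
∣⋃∣-bound {k = zero} P y s _ = ≤-reflexive (trans (cong (y *_) ∣⋃P∣≡0) (*-zeroʳ y))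
  where
  ∣⋃P∣≡0 : ∣ ⋃ P ∣ ≡ 0
  ∣⋃P∣≡0 = n≤0⇒n≡0 (≤-trans (∣∣-mono λ p → contradiction (proj₁ (⋃-elim p)) λ ()) (≤-reflexive ∣∅∣≡0))
∣⋃∣-bound {k = suc k} P y s bound = begin
  y * ∣ ⋃ P ∣                               ≤⟨ *-monoʳ-≤ y (∣∣-mono cover) ⟩
  y * ∣ P zero ∪ ⋃ (P ∘ suc) ∣              ≤⟨ *-monoʳ-≤ y (∣∣-∪ (P zero) _) ⟩
  y * (∣ P zero ∣ + ∣ ⋃ (P ∘ suc) ∣)        ≡⟨ *-distribˡ-+ y ∣ P zero ∣ _ ⟩
  y * ∣ P zero ∣ + y * ∣ ⋃ (P ∘ suc) ∣      ≤⟨ +-mono-≤ (bound zero) (∣⋃∣-bound (P ∘ suc) y s (bound ∘ suc)) ⟩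
  s + k * s                                 ∎
  where
  open ≤-Reasoning
  cover : ⋃ P ⊆ P zero ∪ ⋃ (P ∘ suc)
  cover p with ⋃-elim p
  ... | zero  , q = ∪-introˡ q
  ... | suc i , q = ∪-introʳ (⋃-intro i q)

-- Finite sums and updates of finite families

sum : (Fin k → ℕ) → ℕ
sum {zero}  c = 0
sum {suc k} c = c zero + sum (c ∘ suc)

sum-≤ : ∀ {k} {c : Fin k → ℕ} {b} → (∀ i → c i ≤ b) → sum c ≤ k * b
sum-≤ {zero}  c≤b = z≤n
sum-≤ {suc k} c≤b = +-mono-≤ (c≤b zero) (sum-≤ (c≤b ∘ suc))

sum-mono : ∀ {k} {c d : Fin k → ℕ} → (∀ i → c i ≤ d i) → sum c ≤ sum d
sum-mono {zero}  c≤d = z≤n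
sum-mono {suc k} c≤d = +-mono-≤ (c≤d zero) (sum-mono (c≤d ∘ suc))

sum-mono-< : ∀ {k} {c d : Fin k → ℕ} i → (∀ j → c j ≤ d j) → c i < d i → sum c < sum d
sum-mono-< zero    c≤d lt = +-mono-<-≤ lt (sum-mono (c≤d ∘ suc))
sum-mono-< (suc i) c≤d lt = +-mono-≤-< (c≤d zero) (sum-mono-< i (c≤d ∘ suc) lt)

_[_]≔_ : {X : Set} → (Fin k → X) → Fin k → X → Fin k → X
(f [ i ]≔ x) j with j ≟ i
... | yes _ = x
... | no _  = f j

[]≔-elim : {X : Set} (Q : Fin k → X → Set) {f : Fin k → X} {i : Fin k} {x : X} →
           (∀ j → Q j (f j)) → Q i x → ∀ j → Q j ((f [ i ]≔ x) j)
[]≔-elim Q {i = i} old new j with j ≟ i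
... | yes refl = new
... | no _     = old j

[]≔-elim₂ : {X Y : Set} (Q : Fin k → X → Y → Set) {f : Fin k → X} {g : Fin k → Y} {i : Fin k} {x : X} {y : Y} →
            (∀ j → Q j (f j) (g j)) → Q i x y → ∀ j → Q j ((f [ i ]≔ x) j) ((g [ i ]≔ y) j)
[]≔-elim₂ Q {i = i} old new j with j ≟ i
... | yes refl = new
... | no _     = old j

[]≔-lookup : {X : Set} (f : Fin k → X) (i : Fin k) {x : X} → (f [ i ]≔ x) i ≡ x
[]≔-lookup f i with i ≟ i
... | yes _  = refl
... | no i≢i = contradiction refl i≢i

-- Parameters of the stage with k cores at which f further cores are still to be built. A vertex is
-- added to a core A when 4m times its degree into A is at most |A|; one stage shrinks each
-- core by at most factor m.
factor : ℕ → ℕ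
factor m = 2 * (4 * m)

-- The recursion runs back from the last stage. A surviving core keeps at least a `1 / factor m`
-- part, which costs one factor in sparsity. Richness pays two: one because a large subset of what
-- survives is a smaller part of the old core, one so that the sets removed by regularisation take
-- at most half of a heavy vertex's degree.
sparsity richness : (m f : ℕ) → ℕ
sparsity m zero    = 4 * m
sparsity m (suc f) = factor m * sparsity m f
richness m zero    = 4 * m
richness m (suc f) = factor m * richness m f * factor m

-- `ratio` is the loss in finding a sparse subset, and `steps` bounds the removals of one
-- regularisation, each of which divides the remainder by at most `shrink`. `rounds` is the number
-- of halvings that outweighs all of these, at `2 * ratio` sparse sets each.
module Bounds (m t k f : ℕ) where

  ratio steps shrink rounds peels : ℕ
  ratio  = sparsity m f ^ t
  steps  = k * (factor m * richness m f)
  shrink = suc k * (ratio * richness m f)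
  rounds = sparsity m f + (ratio + shrink * steps)
  peels  = rounds * (2 * ratio)

-- A stage uses one part per core, for what the core leaves behind and absorbs, and `peels` parts
-- for the exhausted vertices; the rest passes to the stage with one core more.
parts : (m t k f : ℕ) → ℕ
parts m t k zero    = k + 0
parts m t k (suc f) = k + (Bounds.peels m t k f + parts m t (suc k) f)

n≤2^n : ∀ n → n ≤ 2 ^ n
n≤2^n zero    = z≤n
n≤2^n (suc n) = begin
  1 + n               ≤⟨ +-mono-≤ (m^n>0 2 n) (n≤2^n n) ⟩
  2 ^ n + 2 ^ n       ≡⟨ cong (2 ^ n +_) (+-identityʳ _) ⟨
  2 ^ suc n           ∎
  where open ≤-Reasoning

*-pos : ∀ {i j} → 0 < i → 0 < j → 0 < i * j
*-pos = *-mono-≤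

^-pos : ∀ {i} j → 0 < i → 0 < i ^ j
^-pos {i} j 0<i = m^n>0 i {{>-nonZero 0<i}} j

-- Cliques, sparse sets and splittings

module InGraph {n : ℕ} (G : Graph n) where

  N : Fin n → Sub n
  N v = adj G v

  deg : Fin n → Sub n → ℕ
  deg v S = ∣ S ∩ N v ∣

  deg-mono : S ⊆ T → deg v S ≤ deg v T
  deg-mono S⊆T = ∣∣-mono λ p → ∩-intro (S⊆T (proj₁ (∩-elim p))) (proj₂ (∩-elim p))

  deg≤∣∣ : deg v S ≤ ∣ S ∣
  deg≤∣∣ = ∣∣-mono (proj₁ ∘ ∩-elim)

  deg-∪ : (S T : Sub n) → deg v (S ∪ T) ≤ deg v S + deg v T
  deg-∪ {v = v} S T = ≤-trans (∣∣-mono distrib) (∣∣-∪ (S ∩ N v) (T ∩ N v))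
    where
    distrib : (S ∪ T) ∩ N v ⊆ S ∩ N v ∪ T ∩ N v
    distrib p with ∩-elim p
    ... | q , w∈N with ∪-elim q
    ...   | inj₁ w∈S = ∪-introˡ (∩-intro w∈S w∈N)
    ...   | inj₂ w∈T = ∪-introʳ (∩-intro w∈T w∈N)

  deg-≤-∖ : (S T : Sub n) → deg v S ≤ deg v T + deg v (S ∖ T)
  deg-≤-∖ {v = v} S T = ≤-trans (deg-mono cover) (deg-∪ T (S ∖ T))
    where
    cover : S ⊆ T ∪ (S ∖ T)
    cover {w} p with w ∈? T
    ... | yes w∈T = ∪-introˡ w∈T
    ... | no  w∉T = ∪-introʳ (∖-intro p w∉T)

  Sparse : ℕ → Sub n → Set
  Sparse α S = ∀ {v} → v ∈ S → α * deg v S ≤ ∣ S ∣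

  Sparse-≤ : ∀ {α β} → α ≤ β → Sparse β S → Sparse α S
  Sparse-≤ α≤β sp v∈S = ≤-trans (*-monoˡ-≤ _ α≤β) (sp v∈S)

  -- The recursion into neighbourhoods fits the greedy descent; the vertices are distinct because no
  -- vertex is its own neighbour.
  Clique : ℕ → Sub n → Set
  Clique zero    S = ⊤
  Clique (suc t) S = ∃[ v ] v ∈ S × Clique t (S ∩ N v)

  Clique-mono : ∀ t → S ⊆ T → Clique t S → Clique t T
  Clique-mono zero    S⊆T _ = tt
  Clique-mono (suc t) S⊆T (v , v∈S , c) =
    v , S⊆T v∈S , Clique-mono t (λ p → ∩-intro (S⊆T (proj₁ (∩-elim p))) (proj₂ (∩-elim p))) c

  Clique⇒copy : ∀ t → Clique t S → InducedCopy (complete t) G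
  Clique⇒copy {S} t c with embed t c
    where
    embed : ∀ t {S} → Clique t S →
            Σ (Fin t → Fin n) λ f → (∀ i → f i ∈ S) × (∀ i j → adj G (f i) (f j) ≡ adj (complete t) i j)
    embed zero    _ = (λ ()) , (λ ()) , λ ()
    embed (suc t) {S} (v , v∈S , c) with embed t c
    ... | g , g∈ , g-adj = f , f∈ , f-adj
      where
      f : Fin (suc t) → Fin n
      f zero    = v
      f (suc i) = g i
      f∈ : ∀ i → f i ∈ S
      f∈ zero    = v∈S
      f∈ (suc i) = proj₁ (∩-elim (g∈ i))
      f-adj : ∀ i j → adj G (f i) (f j) ≡ adj (complete (suc t)) i j
      f-adj zero    zero    = loopless G v
      f-adj zero    (suc j) = isTrue (proj₂ (∩-elim (g∈ j)))
      f-adj (suc i) zero    = trans (Graph.sym G (g i) v) (isTrue (proj₂ (∩-elim (g∈ i))))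
      f-adj (suc i) (suc j) with i ≟ j | g-adj i j
      ... | yes _ | p = p
      ... | no _  | p = p
  ... | f , _ , f-adj = f , f-injective , f-adj
    where
    -- Distinct indices with the same image would make that vertex a neighbour of itself.
    f-injective : ∀ {i j} → f i ≡ f j → i ≡ j
    f-injective {i} {j} fi≡fj with i ≟ j | f-adj i j
    ... | yes i≡j | _ = i≡j
    ... | no  _   | p = contradiction
            (trans (sym (loopless G (f j))) (trans (cong (λ u → adj G u (f j)) (sym fi≡fj)) p)) λ ()

  -- Greedy descent: a vertex that violates sparseness has more than `∣ S ∣ / α` neighbours in `S`,
  -- and among them there is no clique of one vertex fewer. Each step of the induction on clique
  -- size loses a factor `α`.
  sparse-subset : ∀ t {α} → 0 < α → (S : Sub n) → ¬ Clique t S →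
                  ∃[ S′ ] S′ ⊆ S × Sparse α S′ × ∣ S ∣ ≤ α ^ t * ∣ S′ ∣
  sparse-subset zero    0<α S no-clique = contradiction tt no-clique
  sparse-subset (suc t) {α} 0<α S no-clique with any? (λ v → v ∈? S ×-dec (∣ S ∣ <? α * deg v S))
  ... | no none = S , (λ p → p) , (λ {v} v∈S → ≮⇒≥ λ lt → none (v , v∈S , lt)) ,
                  m≤n*m ∣ S ∣ (α ^ suc t) {{m^n≢0 α (suc t) {{>-nonZero 0<α}}}}
  ... | yes (v , v∈S , lt) with sparse-subset t 0<α (S ∩ N v) (λ c → no-clique (v , v∈S , c))
  ...   | S′ , S′⊆ , sp , le = S′ , proj₁ ∘ ∩-elim ∘ S′⊆ , sp , (begin
      ∣ S ∣                      ≤⟨ <⇒≤ lt ⟩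
      α * ∣ S ∩ N v ∣            ≤⟨ *-monoʳ-≤ α le ⟩
      α * (α ^ t * ∣ S′ ∣)       ≡⟨ *-assoc α (α ^ t) _ ⟨
      α ^ suc t * ∣ S′ ∣         ∎)
    where open ≤-Reasoning

  -- Parts are peeled off one after another, so disjointness and covering need no separate proofs. A
  -- part may be empty, which lets `Splits-≤` pad the count.
  data Splits (m : ℕ) : ℕ → Sub n → Set where
    done : ∀ {W} → (∀ {v} → v ∉ W) → Splits m 0 W
    peel : ∀ {k W} S → S ⊆ W → Sparse m S → Splits m k (W ∖ S) → Splits m (suc k) W

  private variable
    m j : ℕ

  Splits-⊆⊇ : W ⊆ W′ → W′ ⊆ W → Splits m k W → Splits m k W′
  Splits-⊆⊇ p q (done empty)       = done (empty ∘ q)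
  Splits-⊆⊇ p q (peel S S⊆W sp ss) = peel S (p ∘ S⊆W) sp (Splits-⊆⊇ (restrict p) (restrict q) ss)
    where
    restrict : ∀ {U U′} → U ⊆ U′ → U ∖ S ⊆ U′ ∖ S
    restrict r x = ∖-intro (r (proj₁ (∖-elim x))) (proj₂ (∖-elim x))

  Splits-++ : U ⊆ W → Splits m j U → Splits m k (W ∖ U) → Splits m (j + k) W
  Splits-++ U⊆W (done empty) rest =
    Splits-⊆⊇ (proj₁ ∘ ∖-elim) (λ p → ∖-intro p empty) rest
  Splits-++ {U = U} {W = W} U⊆W (peel S S⊆U sp ss) rest =
    peel S (U⊆W ∘ S⊆U) sp (Splits-++ U∖S⊆W∖S ss (Splits-⊆⊇ to from rest))
    where
    U∖S⊆W∖S : U ∖ S ⊆ W ∖ S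
    U∖S⊆W∖S p = ∖-intro (U⊆W (proj₁ (∖-elim p))) (proj₂ (∖-elim p))
    to : W ∖ U ⊆ (W ∖ S) ∖ (U ∖ S)
    to p with ∖-elim p
    ... | w , u∉ = ∖-intro (∖-intro w (u∉ ∘ S⊆U)) (u∉ ∘ proj₁ ∘ ∖-elim)
    from : (W ∖ S) ∖ (U ∖ S) ⊆ W ∖ U
    from p with ∖-elim p
    ... | q , ∉U∖S with ∖-elim q
    ...   | w , ∉S = ∖-intro w λ u → ∉U∖S (∖-intro u ∉S)

  Splits-≤ : j ≤ k → Splits m j W → Splits m k W
  Splits-≤ {k = zero}  z≤n     s            = s
  Splits-≤ {k = suc k} z≤n     (done empty) =
    peel ∅ (λ p → contradiction p ∅-elim) (λ p → contradiction p ∅-elim) (Splits-≤ z≤n (done (empty ∘ proj₁ ∘ ∖-elim)))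
  Splits-≤ (s≤s j≤k) (peel S S⊆W sp ss) = peel S S⊆W sp (Splits-≤ j≤k ss)

  Splits-⋃ : ∀ {k} (P : Fin k → Sub n) → (∀ i → Sparse m (P i)) →
             (∀ {i j v} → v ∈ P i → v ∈ P j → i ≡ j) → Splits m k (⋃ P)
  Splits-⋃ {k = zero}  P sp disj = done λ p → contradiction (proj₁ (⋃-elim p)) λ ()
  Splits-⋃ {k = suc k} P sp disj =
    peel (P zero) (⋃-intro zero) (sp zero)
      (Splits-⊆⊇ to from (Splits-⋃ (P ∘ suc) (sp ∘ suc) λ p q → suc-injective (disj p q)))
    where
    to : ⋃ (P ∘ suc) ⊆ ⋃ P ∖ P zero
    to p with ⋃-elim p
    ... | i , q = ∖-intro (⋃-intro (suc i) q) λ r → contradiction (disj q r) λ ()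
    from : ⋃ P ∖ P zero ⊆ ⋃ (P ∘ suc)
    from p with ∖-elim p
    ... | q , ∉P₀ with ⋃-elim q
    ...   | zero  , r = contradiction r ∉P₀
    ...   | suc i , r = ⋃-intro i r

  -- Exhausting a set by sparse subsets

  module Exhaust (m r : ℕ) (0<r : 0 < r)
                 (pick : ∀ W → ∃[ S ] S ⊆ W × Sparse m S × ∣ W ∣ ≤ r * ∣ S ∣) where

    -- As long as at least `X / 2` vertices remain, each peeled set has at least `X / (2 * r)` of
    -- them. The second alternative sums this over `j` rounds and clears the denominator.
    peel-rounds : ∀ X j W → ∃[ W′ ] W′ ⊆ W × Splits m j (W ∖ W′) ×
                  (2 * ∣ W′ ∣ ≤ X ⊎ j * X + 2 * r * ∣ W′ ∣ ≤ 2 * r * ∣ W ∣)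
    peel-rounds X zero W = W , (λ p → p) , done (λ p → proj₂ (∖-elim p) (proj₁ (∖-elim p))) , inj₂ ≤-refl
    peel-rounds X (suc j) W with pick W
    ... | S , S⊆W , sp , ∣W∣≤ with peel-rounds X j (W ∖ S)
    ...   | W′ , W′⊆ , ss , alt =
      W′ , W′⊆W , peel S (λ p → ∖-intro (S⊆W p) λ q → proj₂ (∖-elim (W′⊆ q)) p) sp (Splits-⊆⊇ to from ss) , bound alt
      where
      W′⊆W : W′ ⊆ W
      W′⊆W = proj₁ ∘ ∖-elim ∘ W′⊆
      to : (W ∖ S) ∖ W′ ⊆ (W ∖ W′) ∖ S
      to p with ∖-elim p
      ... | q , ∉W′ with ∖-elim q
      ...   | w , ∉S = ∖-intro (∖-intro w ∉W′) ∉S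
      from : (W ∖ W′) ∖ S ⊆ (W ∖ S) ∖ W′
      from p with ∖-elim p
      ... | q , ∉S with ∖-elim q
      ...   | w , ∉W′ = ∖-intro (∖-intro w ∉S) ∉W′
      bound : 2 * ∣ W′ ∣ ≤ X ⊎ j * X + 2 * r * ∣ W′ ∣ ≤ 2 * r * ∣ W ∖ S ∣ →
              2 * ∣ W′ ∣ ≤ X ⊎ suc j * X + 2 * r * ∣ W′ ∣ ≤ 2 * r * ∣ W ∣
      bound (inj₁ le) = inj₁ le
      bound (inj₂ le) with ≤-total (2 * ∣ W ∣) X
      ... | inj₁ 2W≤X = inj₁ (≤-trans (*-monoʳ-≤ 2 (∣∣-mono W′⊆W)) 2W≤X)
      ... | inj₂ X≤2W = inj₂ (begin
        suc j * X + 2 * r * ∣ W′ ∣                  ≡⟨ +-assoc X (j * X) _ ⟩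
        X + (j * X + 2 * r * ∣ W′ ∣)                ≤⟨ +-mono-≤ X≤2W le ⟩
        2 * ∣ W ∣ + 2 * r * ∣ W ∖ S ∣               ≤⟨ +-monoˡ-≤ _ (*-monoʳ-≤ 2 ∣W∣≤) ⟩
        2 * (r * ∣ S ∣) + 2 * r * ∣ W ∖ S ∣         ≡⟨ cong (_+ 2 * r * ∣ W ∖ S ∣) (*-assoc 2 r ∣ S ∣) ⟨
        2 * r * ∣ S ∣ + 2 * r * ∣ W ∖ S ∣           ≡⟨ *-distribˡ-+ (2 * r) ∣ S ∣ _ ⟨
        2 * r * (∣ S ∣ + ∣ W ∖ S ∣)                 ≤⟨ *-monoʳ-≤ (2 * r) (∣∣-disjoint-∪ S (W ∖ S) λ p q → proj₂ (∖-elim q) p) ⟩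
        2 * r * ∣ S ∪ (W ∖ S) ∣                     ≤⟨ *-monoʳ-≤ (2 * r) (∣∣-mono λ p → [ S⊆W , proj₁ ∘ ∖-elim ]′ (∪-elim p)) ⟩
        2 * r * ∣ W ∣                               ∎)
        where open ≤-Reasoning

    halve : ∀ W → ∃[ W′ ] W′ ⊆ W × Splits m (2 * r) (W ∖ W′) × 2 * ∣ W′ ∣ ≤ ∣ W ∣
    halve W with peel-rounds ∣ W ∣ (2 * r) W
    ... | W′ , W′⊆W , ss , inj₁ le = W′ , W′⊆W , ss , le
    -- With `2 * r` rounds and `X = ∣ W ∣`, the second alternative says that all of `W` has been
    -- peeled off.
    ... | W′ , W′⊆W , ss , inj₂ le = W′ , W′⊆W , ss , ≤-trans (≤-reflexive (cong (2 *_) W′-empty)) z≤n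
      where
      W′-empty : ∣ W′ ∣ ≡ 0
      W′-empty = n≤0⇒n≡0 (+-cancelˡ-≤ ∣ W ∣ ∣ W′ ∣ 0 (≤-trans
        (*-cancelˡ-≤ (2 * r) {{>-nonZero (*-mono-≤ (s≤s (z≤n {1})) 0<r)}}
          (≤-trans (≤-reflexive (*-distribˡ-+ (2 * r) ∣ W ∣ ∣ W′ ∣)) le))
        (≤-reflexive (sym (+-identityʳ ∣ W ∣)))))

    decimate : ∀ x W → ∃[ W′ ] W′ ⊆ W × Splits m (x * (2 * r)) (W ∖ W′) × 2 ^ x * ∣ W′ ∣ ≤ ∣ W ∣
    decimate zero W = W , (λ p → p) , done (λ p → proj₂ (∖-elim p) (proj₁ (∖-elim p))) , ≤-reflexive (*-identityˡ _)
    decimate (suc x) W with halve W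
    ... | W₁ , W₁⊆W , ss₁ , le₁ with decimate x W₁
    ...   | W₂ , W₂⊆W₁ , ss₂ , le₂ = W₂ , W₁⊆W ∘ W₂⊆W₁ , Splits-++ sub ss₁ (Splits-⊆⊇ to from ss₂) , (begin
      2 * 2 ^ x * ∣ W₂ ∣      ≡⟨ *-assoc 2 (2 ^ x) _ ⟩
      2 * (2 ^ x * ∣ W₂ ∣)    ≤⟨ *-monoʳ-≤ 2 le₂ ⟩
      2 * ∣ W₁ ∣              ≤⟨ le₁ ⟩
      ∣ W ∣                   ∎)
      where
      open ≤-Reasoning
      sub : W ∖ W₁ ⊆ W ∖ W₂
      sub p with ∖-elim p
      ... | w , ∉W₁ = ∖-intro w (∉W₁ ∘ W₂⊆W₁)
      to : W₁ ∖ W₂ ⊆ (W ∖ W₂) ∖ (W ∖ W₁)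
      to p with ∖-elim p
      ... | w , ∉W₂ = ∖-intro (∖-intro (W₁⊆W w) ∉W₂) λ q → proj₂ (∖-elim q) w
      from : (W ∖ W₂) ∖ (W ∖ W₁) ⊆ W₁ ∖ W₂
      from {v} p with ∖-elim p | v ∈? W₁
      ... | q , _ | yes ∈W₁ = ∖-intro ∈W₁ (proj₂ (∖-elim q))
      ... | q , ∉ | no ∉W₁  = contradiction (∖-intro (proj₁ (∖-elim q)) ∉W₁) ∉

  -- Regularisation and rich families

  -- A subset of `A i` is large if it has at least `∣ A i ∣ / b` vertices, a vertex is sparse to it
  -- if it has fewer than `∣ A i ∣ / z` neighbours there, and a large set offends if more than a
  -- `1 / y` part of `S` is sparse to it. Degrees are measured against the whole core, as `Rich`
  -- compares sizes with it.
  module Regularize {k : ℕ} (A : Fin k → Sub n) (z b y : ℕ) (0<y : 0 < y) (0<∣A∣ : ∀ i → 0 < ∣ A i ∣) where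

    bad : Fin k → Sub n → Sub n → Sub n
    bad i D S = S ∩ ⟪ (λ v → z * deg v D <? ∣ A i ∣) ⟫

    Violation : Sub n → Sub n → Fin k → Sub n → Set
    Violation S B i D = (∀ v → v ∈ D → v ∈ A i ∖ B) × ∣ A i ∣ ≤ b * ∣ D ∣ × ∣ S ∣ < y * ∣ bad i D S ∣

    violation? : ∀ S B i → Dec (∃[ D ] Violation S B i D)
    violation? S B i = any-subset? resp λ D →
      all? (λ v → v ∈? D →-dec v ∈? (A i ∖ B)) ×-dec (∣ A i ∣ ≤? b * ∣ D ∣) ×-dec (∣ S ∣ <? y * ∣ bad i D S ∣)
      where
      resp : ∀ {D D′} → D ≐ D′ → Violation S B i D → Violation S B i D′
      resp {D} {D′} D≐D′ (D⊆ , big , many) =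
        (λ v → D⊆ v ∘ ≐⇒⊆ (≐-sym D≐D′)) ,
        ≤-trans big (*-monoʳ-≤ b (∣∣-mono (≐⇒⊆ D≐D′))) ,
        ≤-trans many (*-monoʳ-≤ y (∣∣-mono λ p → ∩-intro (proj₁ (∩-elim p))
          (⟪⟫-intro (≤-trans (s≤s (*-monoʳ-≤ z (deg-mono (≐⇒⊆ (≐-sym D≐D′))))) (⟪⟫-elim (proj₂ (∩-elim p)))))))

    -- `B i` collects the sets removed from `A i`. They are disjoint and large, and every surviving
    -- vertex is sparse to each of them, so `few` follows by summation.
    record Regular (F : ℕ) (S : Sub n) : Set where
      field
        B       : Fin k → Sub n
        S′      : Sub n
        B⊆A     : ∀ i → B i ⊆ A i
        S′⊆S    : S′ ⊆ S
        0<∣S′∣  : 0 < ∣ S′ ∣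
        ∣S∣≤    : ∣ S ∣ ≤ y ^ F * ∣ S′ ∣
        few     : ∀ {v} → v ∈ S′ → ∀ i → z * deg v (B i) ≤ b * ∣ B i ∣
        regular : ∀ i {D} → D ⊆ A i ∖ B i → ∣ A i ∣ ≤ b * ∣ D ∣ → y * ∣ bad i D S′ ∣ ≤ ∣ S′ ∣

    -- c i counts the sets removed from A i so far; each has at least |A i| / b vertices, so c i ≤ b.
    regularize-from : ∀ F S (B : Fin k → Sub n) (c : Fin k → ℕ) → 0 < ∣ S ∣ → (∀ i → B i ⊆ A i) →
      (∀ {v} → v ∈ S → ∀ i → z * deg v (B i) ≤ b * ∣ B i ∣) →
      (∀ i → c i * ∣ A i ∣ ≤ b * ∣ B i ∣) → k * b ≤ F + sum c → Regular F S
    regularize-from F S B c 0<∣S∣ B⊆A few cA≤bB budget with any? (λ i → violation? S (B i) i)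
    ... | no none = record
      { B = B ; S′ = S ; B⊆A = B⊆A ; S′⊆S = λ p → p ; 0<∣S′∣ = 0<∣S∣
      ; ∣S∣≤ = m≤n*m ∣ S ∣ (y ^ F) {{m^n≢0 y F {{>-nonZero 0<y}}}}
      ; few = few
      ; regular = λ i {D} D⊆ big → ≮⇒≥ λ many → none (i , D , (λ _ → D⊆) , big , many) }
    ... | yes (i , D , D⊆ , big , many) = continue F budget
      where
      B′ : Fin k → Sub n
      B′ = B [ i ]≔ (B i ∪ D)
      c′ : Fin k → ℕ
      c′ = c [ i ]≔ suc (c i)
      S₁ : Sub n
      S₁ = bad i D S

      ∣B∪D∣ : ∣ B i ∣ + ∣ D ∣ ≤ ∣ B i ∪ D ∣
      ∣B∪D∣ = ∣∣-disjoint-∪ (B i) D λ p q → proj₂ (∖-elim (D⊆ _ q)) p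

      b∣B∪D∣ : b * ∣ B i ∣ + b * ∣ D ∣ ≤ b * ∣ B i ∪ D ∣
      b∣B∪D∣ = ≤-trans (≤-reflexive (sym (*-distribˡ-+ b ∣ B i ∣ ∣ D ∣))) (*-monoʳ-≤ b ∣B∪D∣)

      B′⊆A : ∀ j → B′ j ⊆ A j
      B′⊆A = []≔-elim (λ j X → X ⊆ A j) B⊆A λ p → [ B⊆A i , (λ q → proj₁ (∖-elim (D⊆ _ q))) ]′ (∪-elim p)

      few′ : ∀ {v} → v ∈ S₁ → ∀ j → z * deg v (B′ j) ≤ b * ∣ B′ j ∣
      few′ {v} p = []≔-elim (λ j X → z * deg v X ≤ b * ∣ X ∣) (few (proj₁ (∩-elim p))) (begin
        z * deg v (B i ∪ D)                 ≤⟨ *-monoʳ-≤ z (deg-∪ (B i) D) ⟩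
        z * (deg v (B i) + deg v D)         ≡⟨ *-distribˡ-+ z (deg v (B i)) (deg v D) ⟩
        z * deg v (B i) + z * deg v D       ≤⟨ +-mono-≤ (few (proj₁ (∩-elim p)) i)
                                                 (≤-trans (<⇒≤ (⟪⟫-elim (proj₂ (∩-elim p)))) big) ⟩
        b * ∣ B i ∣ + b * ∣ D ∣             ≤⟨ b∣B∪D∣ ⟩
        b * ∣ B i ∪ D ∣                     ∎)
        where open ≤-Reasoning

      c′A≤bB′ : ∀ j → c′ j * ∣ A j ∣ ≤ b * ∣ B′ j ∣
      c′A≤bB′ = []≔-elim₂ (λ j d X → d * ∣ A j ∣ ≤ b * ∣ X ∣) cA≤bB (begin
        ∣ A i ∣ + c i * ∣ A i ∣       ≤⟨ +-mono-≤ big (cA≤bB i) ⟩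
        b * ∣ D ∣ + b * ∣ B i ∣       ≡⟨ +-comm (b * ∣ D ∣) _ ⟩
        b * ∣ B i ∣ + b * ∣ D ∣       ≤⟨ b∣B∪D∣ ⟩
        b * ∣ B i ∪ D ∣               ∎)
        where open ≤-Reasoning

      c′≤b : ∀ j → c′ j ≤ b
      c′≤b j = *-cancelʳ-≤ (c′ j) b ∣ A j ∣ {{>-nonZero (0<∣A∣ j)}}
                 (≤-trans (c′A≤bB′ j) (*-monoʳ-≤ b (∣∣-mono (B′⊆A j))))

      sum-< : sum c < sum c′
      sum-< = sum-mono-< i ([]≔-elim (λ j d → c j ≤ d) (λ _ → ≤-refl) (n≤1+n _))
                (≤-reflexive (sym ([]≔-lookup c i)))

      0<∣S₁∣ : 0 < ∣ S₁ ∣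
      0<∣S₁∣ = n≢0⇒n>0 λ ∣S₁∣≡0 → contradiction
        (≤-trans many (≤-reflexive (trans (cong (y *_) ∣S₁∣≡0) (*-zeroʳ y)))) λ ()

      continue : ∀ F → k * b ≤ F + sum c → Regular F S
      -- `F` is the number of removals still allowed. A removal raises `sum c`, which cannot exceed
      -- `k * b`, so none can happen once `F` is used up.
      continue zero    budget = contradiction (≤-trans sum-< (≤-trans (sum-≤ c′≤b) budget)) (<-irrefl refl)
      continue (suc F) budget = record
        { B = R.B ; S′ = R.S′ ; B⊆A = R.B⊆A ; S′⊆S = proj₁ ∘ ∩-elim ∘ R.S′⊆S ; 0<∣S′∣ = R.0<∣S′∣
        ; ∣S∣≤ = ≤-trans (<⇒≤ many) (≤-trans (*-monoʳ-≤ y R.∣S∣≤) (≤-reflexive (sym (*-assoc y (y ^ F) _))))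
        ; few = R.few ; regular = R.regular }
        where
        rest : Regular F S₁
        rest = regularize-from F S₁ B′ c′ 0<∣S₁∣ B′⊆A few′ c′A≤bB′
                 (≤-trans budget (≤-trans (≤-reflexive (sym (+-suc F (sum c)))) (+-monoʳ-≤ F sum-<)))
        module R = Regular rest

    regularize : ∀ S → 0 < ∣ S ∣ → Regular (k * b) S
    regularize S 0<∣S∣ = regularize-from (k * b) S (λ _ → ∅) (λ _ → 0) 0<∣S∣ (λ _ p → contradiction p ∅-elim)
      (λ {v} _ i → ≤-trans (*-monoʳ-≤ z (deg≤∣∣ {v = v}))
                     (≤-trans (≤-reflexive (trans (cong (z *_) ∣∅∣≡0) (*-zeroʳ z))) z≤n))
      (λ _ → z≤n) (m≤m+n (k * b) _)

  -- Large means at least a `1 / z` part of the core. The clique need only lie in the union of the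
  -- sets.
  Rich : ∀ {k} → ℕ → (Fin k → Sub n) → Set
  Rich {k} z A = ∀ D → (∀ i → D i ⊆ A i) → (∀ i → ∣ A i ∣ ≤ z * ∣ D i ∣) → Clique k (⋃ D)

  infixr 5 _▸_
  _▸_ : Sub n → (Fin k → Sub n) → Fin (suc k) → Sub n
  (S ▸ A) zero    = S
  (S ▸ A) (suc i) = A i

  module _ {k : ℕ} {A : Fin k → Sub n} {z : ℕ} {S : Sub n} {F : ℕ} (c z′ r : ℕ)
           (0<y : 0 < suc k * (r * z′)) (0<∣A∣ : ∀ i → 0 < ∣ A i ∣) where

    open Regularize A z (c * z′) (suc k * (r * z′)) 0<y 0<∣A∣

    -- Some vertex `v` of `D zero` is sparse to none of the other sets. It has so many neighbours in
    -- each of them that richness of the old cores yields a clique of size `k` among these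
    -- neighbours, which `v` extends.
    Rich-▸ : (reg : Regular F S) → Rich z A →
             {C : Fin k → Sub n} → (∀ i → C i ⊆ A i ∖ Regular.B reg i) → (∀ i → ∣ A i ∣ ≤ c * ∣ C i ∣) →
             {K : Sub n} → K ⊆ Regular.S′ reg → ∣ Regular.S′ reg ∣ ≤ r * ∣ K ∣ → Rich z′ (K ▸ C)
    Rich-▸ reg rich {C} C⊆ A≤cC {K} K⊆S′ S′≤rK D D⊆ big
      with any? (λ v → v ∈? D zero ×-dec ¬? (v ∈? ⋃ bads))
      where
      bads : Fin k → Sub n
      bads i = bad i (D (suc i)) (Regular.S′ reg)
    ... | yes (v , v∈D₀ , v∉bads) = v , ⋃-intro zero v∈D₀ , Clique-mono k into
            (rich (λ i → D (suc i) ∩ N v)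
              (λ i p → proj₁ (∖-elim (C⊆ i (D⊆ (suc i) (proj₁ (∩-elim p))))))
              (λ i → ≮⇒≥ λ lt → v∉bads (⋃-intro i (∩-intro (K⊆S′ (D⊆ zero v∈D₀)) (⟪⟫-intro lt)))))
      where
      into : ⋃ (λ i → D (suc i) ∩ N v) ⊆ ⋃ D ∩ N v
      into p with ⋃-elim p
      ... | i , q = ∩-intro (⋃-intro (suc i) (proj₁ (∩-elim q))) (proj₂ (∩-elim q))
    -- Otherwise the bad sets cover `D zero`. Each is at most a `1 / (suc k * (r * z′))` part of
    -- `S′`, so the `k` of them together are smaller than `D zero`, which is at least a
    -- `1 / (r * z′)` part.
    ... | no none = contradiction (Regular.0<∣S′∣ reg) (<⇒≱ (s≤s (+-cancelʳ-≤ (k * s) s 0 (begin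
        s + k * s                                   ≤⟨ *-monoʳ-≤ (suc k) S′≤rK ⟩
        suc k * (r * ∣ K ∣)                         ≤⟨ *-monoʳ-≤ (suc k) (*-monoʳ-≤ r (big zero)) ⟩
        suc k * (r * (z′ * ∣ D zero ∣))             ≡⟨ cong (suc k *_) (*-assoc r z′ _) ⟨
        suc k * (r * z′ * ∣ D zero ∣)               ≡⟨ *-assoc (suc k) (r * z′) _ ⟨
        suc k * (r * z′) * ∣ D zero ∣               ≤⟨ *-monoʳ-≤ (suc k * (r * z′)) (∣∣-mono covered) ⟩
        suc k * (r * z′) * ∣ ⋃ bads ∣               ≤⟨ ∣⋃∣-bound bads (suc k * (r * z′)) s bound ⟩
        k * s                                       ∎))))
      where
      open ≤-Reasoning
      s : ℕ
      s = ∣ Regular.S′ reg ∣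
      bads : Fin k → Sub n
      bads i = bad i (D (suc i)) (Regular.S′ reg)
      covered : D zero ⊆ ⋃ bads
      covered {v} p with v ∈? ⋃ bads
      ... | yes q = q
      ... | no q  = contradiction (v , p , q) none
      -- The threshold `c * z′` arises here: `D (suc i)` is at least a `1 / z′` part of `C i`, which
      -- is at least a `1 / c` part of `A i`.
      bound : ∀ i → suc k * (r * z′) * ∣ bads i ∣ ≤ s
      bound i = Regular.regular reg i (C⊆ i ∘ D⊆ (suc i))
        (≤-trans (A≤cC i) (≤-trans (*-monoʳ-≤ c (big (suc i))) (≤-reflexive (sym (*-assoc c z′ _)))))

  Splits-▸ : ∀ {k} {C : Fin k → Sub n} {R₁ K R₂ i j} → (∀ i {v} → v ∈ C i → v ∉ R₁) → K ⊆ R₁ → R₂ ⊆ R₁ ∖ K →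
             Splits m i ((R₁ ∖ K) ∖ R₂) → Splits m j (⋃ (K ▸ C) ∪ R₂) → Splits m (i + j) (⋃ C ∪ R₁)
  Splits-▸ {C = C} {R₁} {K} {R₂} C-R₁ K⊆R₁ R₂⊆ peeled rest = Splits-++ sub peeled (Splits-⊆⊇ to from rest)
    where
    sub : (R₁ ∖ K) ∖ R₂ ⊆ ⋃ C ∪ R₁
    sub p = ∪-introʳ (proj₁ (∖-elim (proj₁ (∖-elim p))))
    to : ⋃ (K ▸ C) ∪ R₂ ⊆ (⋃ C ∪ R₁) ∖ ((R₁ ∖ K) ∖ R₂)
    to p with ∪-elim p
    ... | inj₂ r = ∖-intro (∪-introʳ (proj₁ (∖-elim (R₂⊆ r)))) λ q → proj₂ (∖-elim q) r
    ... | inj₁ q with ⋃-elim q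
    ...   | zero  , κ = ∖-intro (∪-introʳ (K⊆R₁ κ)) λ x → proj₂ (∖-elim (proj₁ (∖-elim x))) κ
    ...   | suc i , a = ∖-intro (∪-introˡ (⋃-intro i a)) λ x → C-R₁ i a (proj₁ (∖-elim (proj₁ (∖-elim x))))
    from : (⋃ C ∪ R₁) ∖ ((R₁ ∖ K) ∖ R₂) ⊆ ⋃ (K ▸ C) ∪ R₂
    from {v} p with ∖-elim p
    ... | q , ∉ with ∪-elim q
    ...   | inj₁ a = let i , a′ = ⋃-elim a in ∪-introˡ (⋃-intro (suc i) a′)
    ...   | inj₂ r with v ∈? K | v ∈? R₂
    ...     | yes κ | _     = ∪-introˡ (⋃-intro zero κ)
    ...     | no _  | yes ρ = ∪-introʳ ρ
    ...     | no ¬κ | no ¬ρ = contradiction (∖-intro (∖-intro r ¬κ) ¬ρ) ∉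

  -- A core gives up at least half of its vertices, so that what it leaves behind can absorb the
  -- vertices that were sparse to the whole core.
  half-core : ∀ {A A′ : Sub n} {c} → 4 ≤ c → 2 ≤ ∣ A ∣ → ∣ A ∣ ≤ c * ∣ A′ ∣ →
              ∃[ C ] C ⊆ A′ × ∣ A ∣ ≤ c * ∣ C ∣ × 2 * ∣ C ∣ ≤ ∣ A ∣
  half-core {A} {A′} {c} 4≤c 2≤∣A∣ ∣A∣≤ with ≤-total (2 * ∣ A′ ∣) ∣ A ∣
  ... | inj₁ small = A′ , (λ p → p) , ∣A∣≤ , small
  ... | inj₂ large with subset-of-size A′ ⌊ ∣ A ∣ /2⌋ h≤
    where
    open ≤-Reasoning
    h≤ : ⌊ ∣ A ∣ /2⌋ ≤ ∣ A′ ∣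
    h≤ = *-cancelˡ-≤ 2 (begin
      2 * ⌊ ∣ A ∣ /2⌋               ≡⟨ cong (⌊ ∣ A ∣ /2⌋ +_) (+-identityʳ _) ⟩
      ⌊ ∣ A ∣ /2⌋ + ⌊ ∣ A ∣ /2⌋     ≤⟨ +-monoʳ-≤ ⌊ ∣ A ∣ /2⌋ (⌊n/2⌋≤⌈n/2⌉ ∣ A ∣) ⟩
      ⌊ ∣ A ∣ /2⌋ + ⌈ ∣ A ∣ /2⌉     ≡⟨ ⌊n/2⌋+⌈n/2⌉≡n ∣ A ∣ ⟩
      ∣ A ∣                         ≤⟨ large ⟩
      2 * ∣ A′ ∣                    ∎)
  ...   | C , C⊆A′ , ∣C∣≡h = C , C⊆A′ , subst (λ h → ∣ A ∣ ≤ c * h) (sym ∣C∣≡h) lower ,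
                             subst (λ h → 2 * h ≤ ∣ A ∣) (sym ∣C∣≡h) upper
    where
    open ≤-Reasoning
    h : ℕ
    h = ⌊ ∣ A ∣ /2⌋
    1≤h : 1 ≤ h
    1≤h = ⌊n/2⌋-mono 2≤∣A∣
    ⌈⌉≤ : ⌈ ∣ A ∣ /2⌉ ≤ suc h
    ⌈⌉≤ = ⌊n/2⌋-mono (n≤1+n (suc ∣ A ∣))
    -- As `h` is at least 1, it absorbs the rounding: `∣ A ∣` is at most `2 * h + 1`, hence at most
    -- `3 * h`.
    lower : ∣ A ∣ ≤ c * h
    lower = begin
      ∣ A ∣                   ≡⟨ ⌊n/2⌋+⌈n/2⌉≡n ∣ A ∣ ⟨
      h + ⌈ ∣ A ∣ /2⌉         ≤⟨ +-monoʳ-≤ h ⌈⌉≤ ⟩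
      h + (1 + h)             ≤⟨ +-monoʳ-≤ h (+-monoˡ-≤ h 1≤h) ⟩
      h + (h + h)             ≤⟨ +-monoʳ-≤ h (+-monoʳ-≤ h (m≤m+n h _)) ⟩
      4 * h                   ≤⟨ *-monoˡ-≤ h 4≤c ⟩
      c * h                   ∎
    upper : 2 * h ≤ ∣ A ∣
    upper = begin
      2 * h                   ≡⟨ cong (h +_) (+-identityʳ h) ⟩
      h + h                   ≤⟨ +-monoʳ-≤ h (⌊n/2⌋≤⌈n/2⌉ ∣ A ∣) ⟩
      h + ⌈ ∣ A ∣ /2⌉         ≡⟨ ⌊n/2⌋+⌈n/2⌉≡n ∣ A ∣ ⟩
      ∣ A ∣                   ∎

  -- Absorbing vertices into cores

  module Absorb {k m : ℕ} (A : Fin k → Sub n) (R : Sub n)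
                (A-disjoint : ∀ {i j v} → v ∈ A i → v ∈ A j → i ≡ j) (A-R : ∀ {i v} → v ∈ A i → v ∉ R)
                (A-sparse : ∀ i → Sparse (4 * m) (A i)) (R-small : ∀ i → 4 * m * ∣ R ∣ ≤ ∣ A i ∣) where

    Light : Fin n → Fin k → Set
    Light v i = 4 * m * deg v (A i) ≤ ∣ A i ∣

    light? : ∀ v → Dec (∃[ i ] Light v i)
    light? v = any? λ i → 4 * m * deg v (A i) ≤? ∣ A i ∣

    -- A vertex may be light for several cores; it goes to the one that the search returned. With
    -- the decision as an argument, uniqueness is a case split.
    Goes : ∀ {v} → Dec (∃[ i ] Light v i) → Fin k → Set
    Goes (yes (j , _)) i = j ≡ i
    Goes (no _)        i = ⊥

    goes? : ∀ {v} (d : Dec (∃[ i ] Light v i)) i → Dec (Goes d i)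
    goes? (yes (j , _)) i = j ≟ i
    goes? (no _)        i = no λ ()

    Goes-light : ∀ {v} (d : Dec (∃[ i ] Light v i)) {i} → Goes d i → Light v i
    Goes-light (yes (j , l)) refl = l

    Goes-unique : ∀ {v} (d : Dec (∃[ i ] Light v i)) {i j} → Goes d i → Goes d j → i ≡ j
    Goes-unique (yes _) refl refl = refl

    Goes-total : ∀ {v} (d : Dec (∃[ i ] Light v i)) → ∃[ i ] Light v i → ∃[ i ] Goes d i
    Goes-total (yes (j , _)) _ = j , refl
    Goes-total (no ¬l)       l = contradiction l ¬l

    Z : Fin k → Sub n
    Z i = R ∩ ⟪ (λ v → goes? (light? v) i) ⟫

    R₁ : Sub n
    R₁ = R ∖ ⋃ Z

    R₁⊆R : R₁ ⊆ R
    R₁⊆R = proj₁ ∘ ∖-elim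

    R₁-heavy : ∀ {v} → v ∈ R₁ → ∀ i → ∣ A i ∣ < 4 * m * deg v (A i)
    R₁-heavy {v} p i = ≰⇒> λ l → let j , g = Goes-total (light? v) (i , l) in
      proj₂ (∖-elim p) (⋃-intro j (∩-intro (R₁⊆R p) (⟪⟫-intro g)))

    module _ (C : Fin k → Sub n) (C⊆A : ∀ i → C i ⊆ A i) (C-half : ∀ i → 2 * ∣ C i ∣ ≤ ∣ A i ∣) where

      P : Fin k → Sub n
      P i = (A i ∖ C i) ∪ Z i

      A≤2P : ∀ i → ∣ A i ∣ ≤ 2 * ∣ P i ∣
      A≤2P i = +-cancelˡ-≤ ∣ A i ∣ _ _ (begin
        ∣ A i ∣ + ∣ A i ∣                   ≡⟨ cong (∣ A i ∣ +_) (+-identityʳ _) ⟨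
        2 * ∣ A i ∣                         ≤⟨ *-monoʳ-≤ 2 (∣∣-≤-∖ (A i) (C i)) ⟩
        2 * (∣ C i ∣ + ∣ A i ∖ C i ∣)       ≡⟨ *-distribˡ-+ 2 ∣ C i ∣ _ ⟩
        2 * ∣ C i ∣ + 2 * ∣ A i ∖ C i ∣     ≤⟨ +-mono-≤ (C-half i) (*-monoʳ-≤ 2 (∣∣-mono ∪-introˡ)) ⟩
        ∣ A i ∣ + 2 * ∣ P i ∣               ∎)
        where open ≤-Reasoning

      P-light : ∀ {v} i → v ∈ P i → Light v i
      P-light {v} i p with ∪-elim p
      ... | inj₁ q = A-sparse i (proj₁ (∖-elim q))
      ... | inj₂ q = Goes-light (light? v) (⟪⟫-elim (proj₂ (∩-elim q)))

      -- The degree into the part is at most the degree into `A i` plus `∣ R ∣`, each at most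
      -- `∣ A i ∣ / (4 * m)`. The part has at least half the size of `A i`, so these two factors of
      -- 2 use up the 4.
      P-sparse : ∀ i → Sparse m (P i)
      P-sparse i {v} p = *-cancelˡ-≤ 4 (begin
        4 * (m * deg v (P i))                             ≡⟨ *-assoc 4 m _ ⟨
        4 * m * deg v (P i)                               ≤⟨ *-monoʳ-≤ (4 * m) (deg-∪ (A i ∖ C i) (Z i)) ⟩
        4 * m * (deg v (A i ∖ C i) + deg v (Z i))         ≡⟨ *-distribˡ-+ (4 * m) (deg v (A i ∖ C i)) _ ⟩
        4 * m * deg v (A i ∖ C i) + 4 * m * deg v (Z i)
          ≤⟨ +-mono-≤ (*-monoʳ-≤ (4 * m) (deg-mono (proj₁ ∘ ∖-elim)))
                      (*-monoʳ-≤ (4 * m) (≤-trans deg≤∣∣ (∣∣-mono (proj₁ ∘ ∩-elim)))) ⟩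
        4 * m * deg v (A i) + 4 * m * ∣ R ∣               ≤⟨ +-mono-≤ (P-light i p) (R-small i) ⟩
        ∣ A i ∣ + ∣ A i ∣                                 ≤⟨ +-mono-≤ (A≤2P i) (A≤2P i) ⟩
        2 * ∣ P i ∣ + 2 * ∣ P i ∣                         ≡⟨ *-distribʳ-+ ∣ P i ∣ 2 2 ⟨
        4 * ∣ P i ∣                                       ∎)
        where open ≤-Reasoning

      P-disjoint : ∀ {i j v} → v ∈ P i → v ∈ P j → i ≡ j
      P-disjoint {v = v} p q with ∪-elim p | ∪-elim q
      ... | inj₁ p′ | inj₁ q′ = A-disjoint (proj₁ (∖-elim p′)) (proj₁ (∖-elim q′))
      ... | inj₁ p′ | inj₂ q′ = contradiction (proj₁ (∩-elim q′)) (A-R (proj₁ (∖-elim p′)))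
      ... | inj₂ p′ | inj₁ q′ = contradiction (proj₁ (∩-elim p′)) (A-R (proj₁ (∖-elim q′)))
      ... | inj₂ p′ | inj₂ q′ = Goes-unique (light? v) (⟪⟫-elim (proj₂ (∩-elim p′))) (⟪⟫-elim (proj₂ (∩-elim q′)))

      absorb : ∀ {j} → Splits m j (⋃ C ∪ R₁) → Splits m (k + j) (⋃ A ∪ R)
      absorb rest = Splits-++ ⋃P⊆ (Splits-⋃ P P-sparse P-disjoint) (Splits-⊆⊇ to from rest)
        where
        ⋃P⊆ : ⋃ P ⊆ ⋃ A ∪ R
        ⋃P⊆ p with ⋃-elim p
        ... | i , q with ∪-elim q
        ...   | inj₁ a = ∪-introˡ (⋃-intro i (proj₁ (∖-elim a)))
        ...   | inj₂ z = ∪-introʳ (proj₁ (∩-elim z))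
        C∉P : ∀ {i j v} → v ∈ C i → v ∉ P j
        C∉P {i} c p with ∪-elim p
        ... | inj₂ z = contradiction (proj₁ (∩-elim z)) (A-R (C⊆A i c))
        ... | inj₁ a with A-disjoint (C⊆A i c) (proj₁ (∖-elim a))
        ...   | refl = proj₂ (∖-elim a) c
        R₁∉P : ∀ {j v} → v ∈ R₁ → v ∉ P j
        R₁∉P {j} r p with ∪-elim p
        ... | inj₁ a = A-R (proj₁ (∖-elim a)) (R₁⊆R r)
        ... | inj₂ z = proj₂ (∖-elim r) (⋃-intro j z)
        to : ⋃ C ∪ R₁ ⊆ (⋃ A ∪ R) ∖ ⋃ P
        to p with ∪-elim p
        ... | inj₁ c = let i , q = ⋃-elim c in
                ∖-intro (∪-introˡ (⋃-intro i (C⊆A i q))) λ x → C∉P q (proj₂ (⋃-elim x))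
        ... | inj₂ r = ∖-intro (∪-introʳ (R₁⊆R r)) λ x → R₁∉P r (proj₂ (⋃-elim x))
        from : (⋃ A ∪ R) ∖ ⋃ P ⊆ ⋃ C ∪ R₁
        from {v} p with ∖-elim p
        ... | q , ∉P with ∪-elim q
        ...   | inj₂ r = ∪-introʳ (∖-intro r λ x → ∉P (⋃-intro _ (∪-introʳ (proj₂ (⋃-elim x)))))
        ...   | inj₁ a with ⋃-elim a
        ...     | i , a′ with v ∈? C i
        ...       | yes c = ∪-introˡ (⋃-intro i c)
        ...       | no ¬c = contradiction (⋃-intro i (∪-introˡ (∖-intro a′ ¬c))) ∉P

  -- Adding one core per stage

  module Stage (m t : ℕ) (2≤m : 2 ≤ m) (no-clique : ¬ Clique t full) where

    0<4m : 0 < 4 * m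
    0<4m = *-pos {4} (s≤s z≤n) (≤-trans (s≤s z≤n) 2≤m)

    m≤4m : m ≤ 4 * m
    m≤4m = m≤m+n m _

    0<c : 0 < factor m
    0<c = *-pos {2} (s≤s z≤n) 0<4m

    4m≤c : 4 * m ≤ factor m
    4m≤c = m≤m+n (4 * m) _

    4≤c : 4 ≤ factor m
    4≤c = ≤-trans (≤-trans (m≤m+n 4 4) (*-monoʳ-≤ 4 2≤m)) 4m≤c

    4m≤sparsity : ∀ f → 4 * m ≤ sparsity m f
    4m≤sparsity zero    = ≤-refl
    4m≤sparsity (suc f) = ≤-trans (4m≤sparsity f) (m≤n*m _ (factor m) {{>-nonZero 0<c}})

    0<sparsity : ∀ f → 0 < sparsity m f
    0<sparsity f = ≤-trans 0<4m (4m≤sparsity f)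

    0<richness : ∀ f → 0 < richness m f
    0<richness zero    = 0<4m
    0<richness (suc f) = *-pos (*-pos 0<c (0<richness f)) 0<c

    no-clique-in : ∀ S → ¬ Clique t S
    no-clique-in S c = no-clique (Clique-mono t (λ _ → full-intro) c)

    -- The invariant of the stages. `dominates` keeps the remainder so small that absorbing all of
    -- it into one core would not spoil sparseness.
    record Cores {k} (f : ℕ) (A : Fin k → Sub n) (R : Sub n) : Set where
      field
        disjoint   : ∀ {i j v} → v ∈ A i → v ∈ A j → i ≡ j
        disjoint-R : ∀ {i v} → v ∈ A i → v ∉ R
        sparse     : ∀ i → Sparse (sparsity m f) (A i)
        dominates  : ∀ i → sparsity m f * ∣ R ∣ ≤ ∣ A i ∣
        nonempty   : ∀ i → 0 < ∣ A i ∣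
        rich       : Rich (richness m f) A

    module AbsorbCores {k f : ℕ} {A : Fin k → Sub n} {R : Sub n} (cores : Cores f A R) =
      Absorb {k} {m} A R (Cores.disjoint cores) (Cores.disjoint-R cores)
        (λ i → Sparse-≤ (4m≤sparsity f) (Cores.sparse cores i))
        (λ i → ≤-trans (*-monoˡ-≤ ∣ R ∣ (4m≤sparsity f)) (Cores.dominates cores i))

    -- If no heavy vertex remains, no core has to survive: with `C = ∅` each core becomes a part as
    -- a whole, together with what it absorbs.
    finish : ∀ {k f : ℕ} {A : Fin k → Sub n} {R : Sub n} (cores : Cores f A R) →
             (∀ {v} → v ∉ AbsorbCores.R₁ cores) → Splits m (k + 0) (⋃ A ∪ R)
    finish cores R₁-empty = AbsorbCores.absorb cores (λ _ → ∅) (λ _ p → contradiction p ∅-elim)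
      (λ _ → ≤-trans (≤-reflexive (cong (2 *_) ∣∅∣≡0)) z≤n)
      (done λ p → [ (λ q → ∅-elim (proj₂ (⋃-elim q))) , R₁-empty ]′ (∪-elim p))

    module Extend {k f : ℕ} {A : Fin k → Sub n} {R : Sub n} (cores : Cores (suc f) A R)
                  (0<∣R₁∣ : 0 < ∣ AbsorbCores.R₁ cores ∣) where

      open Cores cores
      open AbsorbCores cores
      open Bounds m t k f

      ℓ z′ c b : ℕ
      ℓ  = sparsity m f
      z′ = richness m f
      c  = factor m
      b  = c * z′

      0<ratio : 0 < ratio
      0<ratio = ^-pos t (0<sparsity f)

      0<shrink : 0 < shrink
      0<shrink = *-pos {suc k} (s≤s z≤n) (*-pos 0<ratio (0<richness f))

      -- `b * c` is by definition the richness of the present cores; `b` and `shrink` are the values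
      -- that `Rich-▸` calls for.
      open Regularize A (b * c) b shrink 0<shrink nonempty

      reg : Regular steps R₁
      reg = regularize R₁ 0<∣R₁∣

      open Regular reg

      -- A surviving vertex is heavy, so it has more than `2 * ∣ A i ∣ / c` neighbours in `A i`, but
      -- by `few` at most `∣ A i ∣ / c` in `B i`. Its other neighbours lie in what is left of `A i`.
      A≤c[A∖B] : ∀ i → ∣ A i ∣ ≤ c * ∣ A i ∖ B i ∣
      A≤c[A∖B] i = let v , v∈S′ = ∣S∣>0⇒∃ S′ 0<∣S′∣ in +-cancelˡ-≤ ∣ A i ∣ _ _ (begin
        ∣ A i ∣ + ∣ A i ∣                           ≡⟨ cong (∣ A i ∣ +_) (+-identityʳ _) ⟨
        2 * ∣ A i ∣                                 ≤⟨ *-monoʳ-≤ 2 (<⇒≤ (R₁-heavy (S′⊆S v∈S′) i)) ⟩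
        2 * (4 * m * deg v (A i))                   ≡⟨ *-assoc 2 (4 * m) _ ⟨
        c * deg v (A i)                             ≤⟨ *-monoʳ-≤ c (deg-≤-∖ (A i) (B i)) ⟩
        c * (deg v (B i) + deg v (A i ∖ B i))       ≡⟨ *-distribˡ-+ c (deg v (B i)) _ ⟩
        c * deg v (B i) + c * deg v (A i ∖ B i)     ≤⟨ +-mono-≤ (B-light v∈S′) (*-monoʳ-≤ c deg≤∣∣) ⟩
        ∣ A i ∣ + c * ∣ A i ∖ B i ∣                 ∎)
        where
        open ≤-Reasoning
        B-light : ∀ {v} → v ∈ S′ → c * deg v (B i) ≤ ∣ A i ∣
        B-light {v} v∈S′ = *-cancelˡ-≤ b {{>-nonZero (*-pos 0<c (0<richness f))}} (begin
          b * (c * deg v (B i))       ≡⟨ *-assoc b c _ ⟨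
          b * c * deg v (B i)         ≤⟨ few v∈S′ i ⟩
          b * ∣ B i ∣                 ≤⟨ *-monoʳ-≤ b (∣∣-mono (B⊆A i)) ⟩
          b * ∣ A i ∣                 ∎)

      2≤∣A∣ : ∀ i → 2 ≤ ∣ A i ∣
      2≤∣A∣ i = begin
        2                               ≤⟨ *-mono-≤ (≤-trans 2≤m (≤-trans m≤4m (4m≤sparsity (suc f)))) 0<∣R∣ ⟩
        sparsity m (suc f) * ∣ R ∣      ≤⟨ dominates i ⟩
        ∣ A i ∣                         ∎
        where
        open ≤-Reasoning
        0<∣R∣ : 1 ≤ ∣ R ∣
        0<∣R∣ = ≤-trans 0<∣R₁∣ (∣∣-mono R₁⊆R)

      halved : ∀ i → ∃[ D ] D ⊆ A i ∖ B i × ∣ A i ∣ ≤ c * ∣ D ∣ × 2 * ∣ D ∣ ≤ ∣ A i ∣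
      halved i = half-core 4≤c (2≤∣A∣ i) (A≤c[A∖B] i)

      C : Fin k → Sub n
      C i = proj₁ (halved i)

      C⊆A∖B : ∀ i → C i ⊆ A i ∖ B i
      C⊆A∖B i = proj₁ (proj₂ (halved i))

      C⊆A : ∀ i → C i ⊆ A i
      C⊆A i = proj₁ ∘ ∖-elim ∘ C⊆A∖B i

      A≤cC : ∀ i → ∣ A i ∣ ≤ c * ∣ C i ∣
      A≤cC i = proj₁ (proj₂ (proj₂ (halved i)))

      pick : ∀ W → ∃[ S ] S ⊆ W × Sparse ℓ S × ∣ W ∣ ≤ ratio * ∣ S ∣
      pick W = sparse-subset t (0<sparsity f) W (no-clique-in W)

      -- The new core is a sparse subset of `S′`, so that the regularity of `S′` passes to it at the
      -- cost of `ratio`.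
      K : Sub n
      K = proj₁ (pick S′)

      K⊆S′ : K ⊆ S′
      K⊆S′ = proj₁ (proj₂ (pick S′))

      K⊆R₁ : K ⊆ R₁
      K⊆R₁ = S′⊆S ∘ K⊆S′

      S′≤K : ∣ S′ ∣ ≤ ratio * ∣ K ∣
      S′≤K = proj₂ (proj₂ (proj₂ (pick S′)))

      pick-m-sparse : ∀ W → ∃[ S ] S ⊆ W × Sparse m S × ∣ W ∣ ≤ ratio * ∣ S ∣
      pick-m-sparse W = let S , S⊆W , sp , le = pick W in
        S , S⊆W , Sparse-≤ (≤-trans m≤4m (4m≤sparsity f)) sp , le

      open Exhaust m ratio 0<ratio pick-m-sparse

      exhausted : ∃[ W ] W ⊆ R₁ ∖ K × Splits m peels ((R₁ ∖ K) ∖ W) × 2 ^ rounds * ∣ W ∣ ≤ ∣ R₁ ∖ K ∣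
      exhausted = decimate rounds (R₁ ∖ K)

      R₂ : Sub n
      R₂ = proj₁ exhausted

      R₂⊆R₁∖K : R₂ ⊆ R₁ ∖ K
      R₂⊆R₁∖K = proj₁ (proj₂ exhausted)

      R₂⊆R : R₂ ⊆ R
      R₂⊆R = R₁⊆R ∘ proj₁ ∘ ∖-elim ∘ R₂⊆R₁∖K

      -- Regularisation may shrink the remainder by the exponential factor `shrink ^ steps`; by
      -- `n≤2^n`, polynomially many halvings outweigh it together with `ratio` and `ℓ`.
      bound-2^ : shrink ^ steps * ratio * ℓ ≤ 2 ^ rounds
      bound-2^ = begin
        shrink ^ steps * ratio * ℓ                    ≡⟨ *-comm _ ℓ ⟩
        ℓ * (shrink ^ steps * ratio)                  ≡⟨ cong (ℓ *_) (*-comm _ ratio) ⟩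
        ℓ * (ratio * shrink ^ steps)                  ≤⟨ *-mono-≤ (n≤2^n ℓ) (*-mono-≤ (n≤2^n ratio)
                                                           (^-monoˡ-≤ steps (n≤2^n shrink))) ⟩
        2 ^ ℓ * (2 ^ ratio * (2 ^ shrink) ^ steps)    ≡⟨ cong (λ x → 2 ^ ℓ * (2 ^ ratio * x)) (^-*-assoc 2 shrink steps) ⟩
        2 ^ ℓ * (2 ^ ratio * 2 ^ (shrink * steps))    ≡⟨ cong (2 ^ ℓ *_) (^-distribˡ-+-* 2 ratio _) ⟨
        2 ^ ℓ * 2 ^ (ratio + shrink * steps)          ≡⟨ ^-distribˡ-+-* 2 ℓ _ ⟨
        2 ^ rounds                                    ∎
        where open ≤-Reasoning

      ℓR₂≤K : ℓ * ∣ R₂ ∣ ≤ ∣ K ∣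
      ℓR₂≤K = *-cancelˡ-≤ (shrink ^ steps * ratio) {{>-nonZero (*-pos (^-pos steps 0<shrink) 0<ratio)}} (begin
        shrink ^ steps * ratio * (ℓ * ∣ R₂ ∣)     ≡⟨ *-assoc (shrink ^ steps * ratio) ℓ ∣ R₂ ∣ ⟨
        shrink ^ steps * ratio * ℓ * ∣ R₂ ∣       ≤⟨ *-monoˡ-≤ ∣ R₂ ∣ bound-2^ ⟩
        2 ^ rounds * ∣ R₂ ∣                       ≤⟨ proj₂ (proj₂ (proj₂ exhausted)) ⟩
        ∣ R₁ ∖ K ∣                                ≤⟨ ∣∣-mono (proj₁ ∘ ∖-elim) ⟩
        ∣ R₁ ∣                                    ≤⟨ ∣S∣≤ ⟩
        shrink ^ steps * ∣ S′ ∣                   ≤⟨ *-monoʳ-≤ (shrink ^ steps) S′≤K ⟩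
        shrink ^ steps * (ratio * ∣ K ∣)          ≡⟨ *-assoc (shrink ^ steps) ratio _ ⟨
        shrink ^ steps * ratio * ∣ K ∣            ∎)
        where open ≤-Reasoning

      extended : Cores f (K ▸ C) R₂
      extended = record
        { disjoint   = λ { {zero}  {zero}  _ _ → refl
                         ; {zero}  {suc j} p q → contradiction (R₁⊆R (K⊆R₁ p)) (disjoint-R (C⊆A j q))
                         ; {suc i} {zero}  p q → contradiction (R₁⊆R (K⊆R₁ q)) (disjoint-R (C⊆A i p))
                         ; {suc i} {suc j} p q → cong suc (disjoint (C⊆A i p) (C⊆A j q)) }
        ; disjoint-R = λ { {zero}  p q → proj₂ (∖-elim (R₂⊆R₁∖K q)) p
                         ; {suc i} p q → disjoint-R (C⊆A i p) (R₂⊆R q) }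
        ; sparse     = λ { zero → proj₁ (proj₂ (proj₂ (pick S′))) ; (suc i) → C-sparse i }
        ; dominates  = λ { zero → ℓR₂≤K ; (suc i) → C-dominates i }
        ; nonempty   = λ { zero → K-nonempty ; (suc i) → C-nonempty i }
        ; rich       = Rich-▸ c z′ ratio 0<shrink nonempty reg rich C⊆A∖B A≤cC K⊆S′ S′≤K }
        where
        open ≤-Reasoning
        instance
          c≢0 : NonZero c
          c≢0 = >-nonZero 0<c
        -- Passing from `A i` to `C i` costs a factor `c`, exactly the quotient of
        -- `sparsity m (suc f)` and `ℓ`.
        C-sparse : ∀ i → Sparse ℓ (C i)
        C-sparse i {v} p = *-cancelˡ-≤ c (begin
          c * (ℓ * deg v (C i))     ≡⟨ *-assoc c ℓ _ ⟨
          c * ℓ * deg v (C i)       ≤⟨ *-monoʳ-≤ (c * ℓ) (deg-mono (C⊆A i)) ⟩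
          c * ℓ * deg v (A i)       ≤⟨ sparse i (C⊆A i p) ⟩
          ∣ A i ∣                   ≤⟨ A≤cC i ⟩
          c * ∣ C i ∣               ∎)
        C-dominates : ∀ i → ℓ * ∣ R₂ ∣ ≤ ∣ C i ∣
        C-dominates i = *-cancelˡ-≤ c (begin
          c * (ℓ * ∣ R₂ ∣)          ≡⟨ *-assoc c ℓ _ ⟨
          c * ℓ * ∣ R₂ ∣            ≤⟨ *-monoʳ-≤ (c * ℓ) (∣∣-mono R₂⊆R) ⟩
          c * ℓ * ∣ R ∣             ≤⟨ dominates i ⟩
          ∣ A i ∣                   ≤⟨ A≤cC i ⟩
          c * ∣ C i ∣               ∎)
        pos-factor : ∀ x {y s} → 0 < s → s ≤ x * y → 0 < y
        pos-factor x {zero}  0<s le = contradiction (≤-trans 0<s (≤-trans le (≤-reflexive (*-zeroʳ x)))) λ ()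
        pos-factor x {suc y} _   _  = s≤s z≤n
        C-nonempty : ∀ i → 0 < ∣ C i ∣
        C-nonempty i = pos-factor c (nonempty i) (A≤cC i)
        K-nonempty : 0 < ∣ K ∣
        K-nonempty = pos-factor ratio 0<∣S′∣ S′≤K

      reassemble : ∀ {j} → Splits m j (⋃ (K ▸ C) ∪ R₂) → Splits m (k + (peels + j)) (⋃ A ∪ R)
      reassemble rest = absorb C C⊆A (λ i → proj₂ (proj₂ (proj₂ (halved i))))
        (Splits-▸ (λ i c r → disjoint-R (C⊆A i c) (R₁⊆R r)) K⊆R₁ R₂⊆R₁∖K (proj₁ (proj₂ (proj₂ exhausted))) rest)

    -- Induction on the number of cores still to be built. If absorption leaves no heavy vertex, the
    -- cores are finished at once; otherwise the heavy vertices supply one more core.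
    split-cores : ∀ {k} f {A : Fin k → Sub n} {R} → suc (k + f) ≡ t → Cores f A R →
                  Splits m (parts m t k f) (⋃ A ∪ R)
    -- With `t - 1` cores, a heavy vertex is adjacent to at least a `1 / (4 * m)` part of each core,
    -- and `4 * m` is the richness of the last stage. The clique found among its neighbours,
    -- together with the vertex, has size `t`.
    split-cores {k} zero {A} k+1≡t cores = finish cores λ {v} v∈R₁ →
      no-clique (subst (λ u → Clique u full) (trans (cong suc (sym (+-identityʳ k))) k+1≡t)
        (v , full-intro , Clique-mono k (into v)
          (Cores.rich cores (λ i → A i ∩ N v) (λ i → proj₁ ∘ ∩-elim) (λ i → <⇒≤ (R₁-heavy v∈R₁ i)))))
      where
      open AbsorbCores cores
      into : ∀ v → ⋃ (λ i → A i ∩ N v) ⊆ full ∩ N v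
      into v p = ∩-intro full-intro (proj₂ (∩-elim (proj₂ (⋃-elim p))))
    split-cores {k} (suc f) {A} {R} k+f≡t cores with 0 <? ∣ AbsorbCores.R₁ cores ∣
    ... | no empty = Splits-≤ (+-monoʳ-≤ k z≤n) (finish cores λ v∈R₁ → empty (v∈S⇒∣S∣>0 v∈R₁))
    ... | yes 0<∣R₁∣ = reassemble (split-cores f (trans (cong suc (sym (+-suc k f))) k+f≡t) extended)
      where open Extend cores 0<∣R₁∣

    -- The first stage has no cores and the whole vertex set as remainder, so the invariant holds
    -- trivially.
    split-all : ∀ f → suc f ≡ t → Splits m (parts m t 0 f) full
    split-all f f+1≡t = Splits-⊆⊇ (λ _ → full-intro) ∪-introʳ (split-cores f {A = λ ()} f+1≡t record
      { disjoint = λ { {()} } ; disjoint-R = λ { {()} } ; sparse = λ () ; dominates = λ ()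
      ; nonempty = λ () ; rich = λ _ _ _ → tt })

  -- From splittings to colourings

  Sparse-⊆⊇ : ∀ α → S ⊆ T → T ⊆ S → Sparse α S → Sparse α T
  Sparse-⊆⊇ α p q sp v∈T = ≤-trans (*-monoʳ-≤ α (deg-mono q)) (≤-trans (sp (q v∈T)) (∣∣-mono p))

  class : ∀ {k} → (Fin n → Fin k) → Fin k → Sub n
  class f c = ⟪ (λ v → f v ≟ c) ⟫

  module _ {k : ℕ} {S : Sub n} where

    paint : ∀ {v} → Dec (v ∈ S) → Fin (suc k) → Fin (suc (suc k))
    paint (yes _) _       = suc zero
    paint (no _)  zero    = zero
    paint (no _)  (suc c) = suc (suc c)

    paint≡0 : ∀ {v} (d : Dec (v ∈ S)) {c} → paint d c ≡ zero → v ∉ S × c ≡ zero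
    paint≡0 (no v∉S) {zero} _ = v∉S , refl

    paint≡1 : ∀ {v} (d : Dec (v ∈ S)) {c} → paint d c ≡ suc zero → v ∈ S
    paint≡1 (yes v∈S) _ = v∈S
    paint≡1 (no _) {zero}  ()
    paint≡1 (no _) {suc c} ()

    paint-∈ : ∀ {v} (d : Dec (v ∈ S)) {c} → v ∈ S → paint d c ≡ suc zero
    paint-∈ (yes _)  _   = refl
    paint-∈ (no v∉S) v∈S = contradiction v∈S v∉S

    paint≡suc : ∀ {v} (d : Dec (v ∈ S)) {c e} → paint d c ≡ suc (suc e) → c ≡ suc e
    paint≡suc (no _) {suc c} refl = refl

    paint-∉ : ∀ {v} (d : Dec (v ∈ S)) {c} → v ∉ S → paint d (suc c) ≡ suc (suc c)
    paint-∉ (yes v∈S) v∉S = contradiction v∈S v∉S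
    paint-∉ (no _)    _   = refl

  -- Colour 0 is reserved for the vertices outside W.
  Splits⇒colouring : ∀ {k} → Splits m k W →
    Σ (Fin n → Fin (suc k)) λ f → (∀ {v} → f v ≡ zero → v ∉ W) × (∀ {v c} → f v ≡ suc c → v ∈ W) ×
                                   (∀ c → Sparse m (class f (suc c)))
  Splits⇒colouring (done empty) = (λ _ → zero) , (λ _ → empty) , (λ ()) , λ ()
  Splits⇒colouring {m = m} {W = W} {k = suc k} (peel S S⊆W sp ss) with Splits⇒colouring ss
  ... | g , g-out , g-in , g-sparse = f , out , (λ {v} {c} → inside {v} {c}) , sparse
    where
    f : Fin n → Fin (suc (suc k))
    f v = paint (v ∈? S) (g v)
    out : ∀ {v} → f v ≡ zero → v ∉ W
    out {v} fv≡0 v∈W = let v∉S , gv≡0 = paint≡0 (v ∈? S) fv≡0 in g-out gv≡0 (∖-intro v∈W v∉S)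
    inside : ∀ {v c} → f v ≡ suc c → v ∈ W
    inside {v} {zero}  fv≡ = S⊆W (paint≡1 (v ∈? S) fv≡)
    inside {v} {suc c} fv≡ = proj₁ (∖-elim (g-in (paint≡suc (v ∈? S) fv≡)))
    sparse : ∀ c → Sparse m (class f (suc c))
    sparse zero = Sparse-⊆⊇ m (λ {v} p → ⟪⟫-intro (paint-∈ (v ∈? S) p)) (λ {v} p → paint≡1 (v ∈? S) (⟪⟫-elim p)) sp
    sparse (suc c) = Sparse-⊆⊇ m to from (g-sparse c)
      where
      to : class g (suc c) ⊆ class f (suc (suc c))
      to {v} p = ⟪⟫-intro (trans (cong (paint (v ∈? S)) (⟪⟫-elim p))
                                 (paint-∉ (v ∈? S) (proj₂ (∖-elim (g-in (⟪⟫-elim p))))))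
      from : class f (suc (suc c)) ⊆ class g (suc c)
      from {v} p = ⟪⟫-intro (paint≡suc (v ∈? S) (⟪⟫-elim p))

  -- For a splitting of the full set no vertex gets the reserved colour, so its class is empty and
  -- hence sparse; it accounts for the extra class.
  Splits⇒sparse-classes : ∀ {k} → Splits m k full →
                          Σ (Fin n → Fin (suc k)) λ f → ∀ c → Sparse m (class f c)
  Splits⇒sparse-classes s with Splits⇒colouring s
  ... | f , out , _ , sparse = f , λ
    { zero    p → contradiction full-intro (out (⟪⟫-elim p))
    ; (suc c) → sparse c }

  opaque
    unfolding _∩_ ∣_∣ ⟪_⟫

    -- The hypothesis `q ≤ p * m` says that `1 / m` is at most `p / q`; unfolding the opaque
    -- definitions turns sparseness into a bound on `degIn`.
    Sparse⇒MaxDegAtMost : ∀ {k} p q m (f : Fin n → Fin k) c → q ≤ p * m → Sparse m (class f c) →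
                          MaxDegAtMost G p q (λ v → f v == c)
    Sparse⇒MaxDegAtMost p q m f c q≤pm sp v v∈c = begin
      q * d              ≤⟨ *-monoˡ-≤ d q≤pm ⟩
      p * m * d          ≡⟨ *-assoc p m d ⟩
      p * (m * d)        ≤⟨ *-monoʳ-≤ p (sp (mem v∈c)) ⟩
      p * count (λ v → f v == c)   ∎
      where
      open ≤-Reasoning
      d : ℕ
      d = degIn G (λ v → f v == c) v

-- Polynomial bounds

-- A pure power without leading constant, as the final bound requires; for `m` at least 2 the
-- exponent absorbs constants and sums.
PolyBounded : (ℕ → ℕ) → Set
PolyBounded f = ∃[ c ] (∀ {m} → 2 ≤ m → f m ≤ m ^ c)

private variable
  f g : ℕ → ℕ

^-distribʳ-* : ∀ i j e → (i * j) ^ e ≡ i ^ e * j ^ e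
^-distribʳ-* i j zero    = refl
^-distribʳ-* i j (suc e) = trans (cong (i * j *_) (^-distribʳ-* i j e)) ([m*n]*[o*p]≡[m*o]*[n*p] i j (i ^ e) (j ^ e))

m≥2⇒NonZero : ∀ {m} → 2 ≤ m → NonZero m
m≥2⇒NonZero 2≤m = >-nonZero (≤-trans (s≤s z≤n) 2≤m)

poly-id : PolyBounded (λ m → m)
poly-id = 1 , λ {m} _ → ≤-reflexive (sym (*-identityʳ m))

poly-const : ∀ a → PolyBounded (λ _ → a)
poly-const a = a , λ 2≤m → ≤-trans (n≤2^n a) (^-monoˡ-≤ a 2≤m)

poly-* : PolyBounded f → PolyBounded g → PolyBounded (λ m → f m * g m)
poly-* (c , F) (d , G) = c + d , λ {m} 2≤m →
  ≤-trans (*-mono-≤ (F 2≤m) (G 2≤m)) (≤-reflexive (sym (^-distribˡ-+-* m c d)))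

poly-+ : PolyBounded f → PolyBounded g → PolyBounded (λ m → f m + g m)
poly-+ {f} {g} (c , F) (d , G) = suc (c + d) , bound
  where
  bound : ∀ {m} → 2 ≤ m → f m + g m ≤ m ^ suc (c + d)
  bound {m} 2≤m = begin
    f m + g m                       ≤⟨ +-mono-≤ (F 2≤m) (G 2≤m) ⟩
    m ^ c + m ^ d                   ≤⟨ +-mono-≤ (^-monoʳ-≤ m (m≤m+n c d)) (^-monoʳ-≤ m (m≤n+m d c)) ⟩
    m ^ (c + d) + m ^ (c + d)       ≡⟨ cong (m ^ (c + d) +_) (+-identityʳ _) ⟨
    2 * m ^ (c + d)                 ≤⟨ *-monoˡ-≤ (m ^ (c + d)) 2≤m ⟩
    m ^ suc (c + d)                 ∎
    where
    open ≤-Reasoning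
    instance
      m≢0 : NonZero m
      m≢0 = m≥2⇒NonZero 2≤m

poly-^ : ∀ e → PolyBounded f → PolyBounded (λ m → f m ^ e)
poly-^ zero    _ = poly-const 1
poly-^ (suc e) p = poly-* p (poly-^ e p)

poly-factor : PolyBounded factor
poly-factor = poly-* (poly-const 2) (poly-* (poly-const 4) poly-id)

poly-sparsity : ∀ e → PolyBounded (λ m → sparsity m e)
poly-sparsity zero    = poly-* (poly-const 4) poly-id
poly-sparsity (suc e) = poly-* poly-factor (poly-sparsity e)

poly-richness : ∀ e → PolyBounded (λ m → richness m e)
poly-richness zero    = poly-* (poly-const 4) poly-id
poly-richness (suc e) = poly-* (poly-* poly-factor (poly-richness e)) poly-factor

poly-peels : ∀ t k e → PolyBounded (λ m → Bounds.peels m t k e)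
poly-peels t k e = poly-* (poly-+ (poly-sparsity e) (poly-+ ratio (poly-* shrink steps))) (poly-* (poly-const 2) ratio)
  where
  ratio : PolyBounded (λ m → Bounds.ratio m t k e)
  ratio = poly-^ t (poly-sparsity e)
  steps : PolyBounded (λ m → Bounds.steps m t k e)
  steps = poly-* (poly-const k) (poly-* poly-factor (poly-richness e))
  shrink : PolyBounded (λ m → Bounds.shrink m t k e)
  shrink = poly-* (poly-const (suc k)) (poly-* ratio (poly-richness e))

poly-parts : ∀ t k e → PolyBounded (λ m → parts m t k e)
poly-parts t k zero    = poly-const (k + 0)
poly-parts t k (suc e) = poly-+ (poly-const k) (poly-+ (poly-peels t k e) (poly-parts t (suc k) e))

-- m = ⌊q/p⌋ + 1, so that 1/m < p/q and, as p/q ≤ 1/2, also m ≤ 2q/p ≤ (q/p)².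
reciprocal : ∀ p q → 0 < p → 2 * p ≤ q → ∃[ m ] 2 ≤ m × q ≤ p * m × m * p ^ 2 ≤ q ^ 2
reciprocal p q 0<p 2p≤q = m , 2≤m , q≤pm , mp²≤q²
  where
  open ≤-Reasoning
  instance
    p≢0 : NonZero p
    p≢0 = >-nonZero 0<p
  m : ℕ
  m = suc (q / p)
  q≤pm : q ≤ p * m
  q≤pm = begin
    q                       ≡⟨ m≡m%n+[m/n]*n q p ⟩
    q % p + q / p * p       ≤⟨ +-monoˡ-≤ _ (<⇒≤ (m%n<n q p)) ⟩
    m * p                   ≡⟨ *-comm m p ⟩
    p * m                   ∎
  2≤m : 2 ≤ m
  2≤m = *-cancelˡ-≤ p (begin
    p * 2                   ≡⟨ *-comm p 2 ⟩
    2 * p                   ≤⟨ 2p≤q ⟩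
    q                       ≤⟨ q≤pm ⟩
    p * m                   ∎)
  mp≤2q : m * p ≤ 2 * q
  mp≤2q = begin
    p + q / p * p           ≤⟨ +-mono-≤ (≤-trans (m≤m+n p _) 2p≤q) (m/n*n≤m q p) ⟩
    q + q                   ≡⟨ cong (q +_) (+-identityʳ q) ⟨
    2 * q                   ∎
  mp²≤q² : m * p ^ 2 ≤ q ^ 2
  mp²≤q² = begin
    m * (p * (p * 1))       ≡⟨ cong (λ x → m * (p * x)) (*-identityʳ p) ⟩
    m * (p * p)             ≡⟨ *-assoc m p p ⟨
    m * p * p               ≤⟨ *-monoˡ-≤ p mp≤2q ⟩
    2 * q * p               ≡⟨ cong (_* p) (*-comm 2 q) ⟩
    q * 2 * p               ≡⟨ *-assoc q 2 p ⟩
    q * (2 * p)             ≤⟨ *-monoʳ-≤ q 2p≤q ⟩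
    q * q                   ≡⟨ cong (q *_) (*-identityʳ q) ⟨
    q ^ 2                   ∎

-- Transfer to a rational bound p/q

theorem7 : (t : ℕ) → ∃[ C ] (0 < C × (∀ (p q : ℕ) → 0 < p → 2 * p ≤ q →
    ∀ (n : ℕ) (G : Graph n) → Free (complete t) G →
    ∃[ k ] (k * p ^ C ≤ q ^ C × Σ (Fin n → Fin k) λ part →
    ∀ (c : Fin k) → StronglyRestricted G p q (λ v → part v == c))))
-- The empty graph embeds into every graph, so no graph is free of it.
theorem7 zero = 1 , s≤s z≤n , λ _ _ _ _ n G free →
  contradiction ((λ ()) , (λ { {()} }) , λ ()) free
-- The constant 1 counts the reserved colour.
theorem7 (suc s) with poly-+ (poly-const 1) (poly-parts (suc s) 0 s)
-- The 2 turns powers of `m` into powers of `q / p`, as `m` is at most the square of `q / p`;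
-- `suc e` keeps the exponent positive.
... | e , bound = 2 * suc e , s≤s z≤n , split
  where
  split : ∀ (p q : ℕ) → 0 < p → 2 * p ≤ q → ∀ (n : ℕ) (G : Graph n) → Free (complete (suc s)) G →
          ∃[ k ] (k * p ^ (2 * suc e) ≤ q ^ (2 * suc e) × Σ (Fin n → Fin k) λ part →
          ∀ (c : Fin k) → StronglyRestricted G p q (λ v → part v == c))
  split p q 0<p 2p≤q n G free with reciprocal p q 0<p 2p≤q
  ... | m , 2≤m , q≤pm , mp²≤q² = suc ♯ , few , colour , λ c → inj₁ (Sparse⇒MaxDegAtMost p q m colour c q≤pm (sparse c))
    where
    open InGraph G
    open ≤-Reasoning
    ♯ : ℕ
    ♯ = parts m (suc s) 0 s
    classes : Σ (Fin n → Fin (suc ♯)) λ f → ∀ c → Sparse m (class f c)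
    classes = Splits⇒sparse-classes (Stage.split-all m (suc s) 2≤m (λ c → free (Clique⇒copy (suc s) c)) s refl)
    colour : Fin n → Fin (suc ♯)
    colour = proj₁ classes
    sparse : ∀ c → Sparse m (class colour c)
    sparse = proj₂ classes
    few : suc ♯ * p ^ (2 * suc e) ≤ q ^ (2 * suc e)
    few = begin
      suc ♯ * p ^ (2 * suc e)             ≤⟨ *-monoˡ-≤ _ (≤-trans (bound 2≤m)
                                               (^-monoʳ-≤ m {{m≥2⇒NonZero 2≤m}} (n≤1+n e))) ⟩
      m ^ suc e * p ^ (2 * suc e)         ≡⟨ cong (m ^ suc e *_) (^-*-assoc p 2 (suc e)) ⟨
      m ^ suc e * (p ^ 2) ^ suc e         ≡⟨ ^-distribʳ-* m (p ^ 2) (suc e) ⟨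
      (m * p ^ 2) ^ suc e                 ≤⟨ ^-monoˡ-≤ (suc e) mp²≤q² ⟩
      (q ^ 2) ^ suc e                     ≡⟨ ^-*-assoc q 2 (suc e) ⟩
      q ^ (2 * suc e)                     ∎
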